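{- Let $\Delta$ be an odd positive integer, let $\mathcal{R}=\mathrm{GR}(4^\Delta)=\mathbb{Z}_4[\xi]$, where $\xi$ is a root of order $2^\Delta-1$ of a basic primitive polynomial of degree $\Delta$ over $\mathbb{Z}_4$. Then there is a partition of $\mathcal{R}\setminus\{0\}$ into $2^\Delta-1$ triples ($3$-element sets) of the form $\{a,2a,3a\}$ and $\frac{(2^\Delta-1)(2^\Delta-2)}{6}$ sixtuples ($6$-element sets) of the form $\{\pm a,\pm b,\pm(a+b)\}$ (with $a,b\in\mathcal{R}$) such that the partition is invariant under multiplication by $\xi$ and, if $\Delta\not\equiv 0 \bmod 3$, the partition is also invariant under the action of every ring automorphism of $\mathrm{GR}(4^\Delta)$.
   Context: A basic primitive polynomial of degree $\Delta$ over $\mathbb{Z}_4$ is a monic polynomial $h(x)\in\mathbb{Z}_4[x]$ of degree $\Delta$ whose reduction modulo $2$ is a primitive polynomial over $\mathbb{F}_2$; it is chosen so that $h$ divides $x^{2^\Delta-1}-1$ in $\mathbb{Z}_4[x]$, hence its root $\xi$ (the class of $x$) has multiplicative order $2^\Delta-1$. The Galois ring is $\mathrm{GR}(4^\Delta)=\mathbb{Z}_4[x]/(h(x))$, a ring with $4^\Delta$ elements. A partition is invariant under a bijection $\varphi$ of $\mathcal{R}$ fixing $0$ if $\varphi$ maps every cell of the partition onto a cell of the partition. -}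

module Defs where

open import Algebra.Bundles.Raw using (RawRing)
import Algebra.Definitions.RawSemiring as RawSemiringDefinitions
import Algebra.Morphism.Structures as MorphismStructures
open import Data.Integer.Base using (+_; +-*-rawRing)
open import Data.List.Base using (List; []; _∷_; map)
open import Data.List.Relation.Unary.AllPairs using (AllPairs)
open import Data.List.Relation.Unary.Any using (Any)
open import Data.Nat.Base using (ℕ; zero; suc; _<_; _∸_) renaming (_^_ to _^ℕ_)
open import Data.Product.Base using (∃-syntax; _×_)
open import Level using (Level; 0ℓ; _⊔_)
open import Relation.Binary.PropositionalEquality.Core using (_≡_)
open import Relation.Nullary.Negation.Core using (¬_)
open import Relation.Unary using (Pred; _∈_; _⊆_; _≐_; Satisfiable)

private
  variable
    c ℓ i p q : Level

-- The quotient of a commutative ring by the principal ideal generated by m: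
-- the same representatives, identified when m divides their difference.
_/⟨_⟩ : (R : RawRing c ℓ) → RawRing.Carrier R → RawRing c (c ⊔ ℓ)
R /⟨ m ⟩ = record
  { Carrier = Carrier
  ; _≈_     = λ x y → m ∣ (x + - y)
  ; _+_     = _+_
  ; _*_     = _*_
  ; -_      = -_
  ; 0#      = 0#
  ; 1#      = 1#
  }
  where
  open RawRing R
  open RawSemiringDefinitions rawSemiring using (_∣_)

-- Polynomials in one variable as coefficient lists, constant term first.
-- Trailing zeros are allowed, so equality compares all coefficients.
module Polynomial (R : RawRing c ℓ) where
  open RawRing R

  coeff : List Carrier → ℕ → Carrier
  coeff []      _       = 0#
  coeff (a ∷ f) zero    = a
  coeff (a ∷ f) (suc n) = coeff f n

  add : List Carrier → List Carrier → List Carrier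
  add []      g       = g
  add (a ∷ f) []      = a ∷ f
  add (a ∷ f) (b ∷ g) = (a + b) ∷ add f g

  mul : List Carrier → List Carrier → List Carrier
  mul []      g = []
  mul (a ∷ f) g = add (map (a *_) g) (0# ∷ mul f g)

  rawRing : RawRing c ℓ
  rawRing = record
    { Carrier = List Carrier
    ; _≈_     = λ f g → ∀ n → coeff f n ≈ coeff g n
    ; _+_     = add
    ; _*_     = mul
    ; -_      = map -_
    ; 0#      = []
    ; 1#      = 1# ∷ []
    }

  X : List Carrier
  X = 0# ∷ 1# ∷ []

  record MonicOfDegree (d : ℕ) (f : List Carrier) : Set ℓ where
    field
      leading : coeff f d ≈ 1#
      above   : ∀ {n} → d < n → coeff f n ≈ 0#

_[X] : RawRing c ℓ → RawRing c ℓ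
R [X] = Polynomial.rawRing R

record HasOrder (R : RawRing c ℓ) (x : RawRing.Carrier R) (n : ℕ) : Set ℓ where
  open RawRing R
  open RawSemiringDefinitions rawSemiring using (_^_)
  field
    positive : 0 < n
    power    : x ^ n ≈ 1#
    minimal  : ∀ {m} → 0 < m → m < n → ¬ (x ^ m ≈ 1#)

ℤ₄ 𝔽₂ : RawRing 0ℓ 0ℓ
ℤ₄ = +-*-rawRing /⟨ + 4 ⟩
𝔽₂ = +-*-rawRing /⟨ + 2 ⟩

ℤ₄[X] 𝔽₂[X] : RawRing 0ℓ 0ℓ
ℤ₄[X] = ℤ₄ [X]
𝔽₂[X] = 𝔽₂ [X]

-- Elements of both ℤ₄ and 𝔽₂ are represented by integers, so reduction
-- modulo 2 keeps the representatives and only coarsens the equality.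
mod2 : RawRing.Carrier ℤ₄[X] → RawRing.Carrier 𝔽₂[X]
mod2 f = f

-- A primitive polynomial is the minimal polynomial of a generator of the
-- multiplicative group of the field with 2 ^ d elements; here that field is
-- 𝔽₂[X]/(f) and the generator is the class of X.
record IsPrimitive (d : ℕ) (f : RawRing.Carrier 𝔽₂[X]) : Set where
  open Polynomial 𝔽₂ using (X; MonicOfDegree)
  open RawSemiringDefinitions (RawRing.rawSemiring 𝔽₂[X]) using (Irreducible)
  field
    monic       : MonicOfDegree d f
    irreducible : Irreducible f
    order       : HasOrder (𝔽₂[X] /⟨ f ⟩) X (2 ^ℕ d ∸ 1)

record IsBasicPrimitive (d : ℕ) (h : RawRing.Carrier ℤ₄[X]) : Set where
  open RawRing ℤ₄[X] using (_+_; -_; 1#; rawSemiring)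
  open Polynomial ℤ₄ using (X; MonicOfDegree)
  open RawSemiringDefinitions rawSemiring using (_∣_; _^_)
  field
    monic     : MonicOfDegree d h
    reduction : IsPrimitive d (mod2 h)
    divides   : h ∣ X ^ (2 ^ℕ d ∸ 1) + - 1#

GR : RawRing.Carrier ℤ₄[X] → RawRing 0ℓ 0ℓ
GR h = ℤ₄[X] /⟨ h ⟩

ξ : (h : RawRing.Carrier ℤ₄[X]) → RawRing.Carrier (GR h)
ξ h = Polynomial.X ℤ₄

module Cells (R : RawRing c ℓ) where
  open RawRing R
  open RawSemiringDefinitions rawSemiring using () renaming (_×_ to _·_)

  Elements : List Carrier → Pred Carrier (c ⊔ ℓ)
  Elements xs x = Any (x ≈_) xs

  -- C consists of exactly the listed elements, which are pairwise distinct.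
  Enumerates : List Carrier → Pred Carrier p → Set (c ⊔ ℓ ⊔ p)
  Enumerates xs C = AllPairs _≉_ xs × C ≐ Elements xs

  IsTriple : Pred Carrier p → Set (c ⊔ ℓ ⊔ p)
  IsTriple C = ∃[ a ] Enumerates (a ∷ 2 · a ∷ 3 · a ∷ []) C

  IsSixtuple : Pred Carrier p → Set (c ⊔ ℓ ⊔ p)
  IsSixtuple C = ∃[ a ] ∃[ b ]
    Enumerates (a ∷ - a ∷ b ∷ - b ∷ (a + b) ∷ - (a + b) ∷ []) C

  record IsPartition {I : Set i} (cell : I → Pred Carrier p)
                     (U : Pred Carrier q) : Set (c ⊔ i ⊔ p ⊔ q) where
    field
      nonempty : ∀ j → Satisfiable (cell j)
      inside   : ∀ j → cell j ⊆ U
      covers   : ∀ {x} → x ∈ U → ∃[ j ] x ∈ cell j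
      disjoint : ∀ {x j k} → x ∈ cell j → x ∈ cell k → j ≡ k

  Nonzero : Pred Carrier ℓ
  Nonzero x = ¬ (x ≈ 0#)

  Image : (Carrier → Carrier) → Pred Carrier p → Pred Carrier (c ⊔ ℓ ⊔ p)
  Image φ C y = ∃[ x ] (x ∈ C × φ x ≈ y)

  InvariantUnder : {I : Set i} → (I → Pred Carrier p) → (Carrier → Carrier) →
                   Set (c ⊔ ℓ ⊔ i ⊔ p)
  InvariantUnder cell φ = ∀ j → ∃[ k ] (Image φ (cell j) ≐ cell k)

IsRingAutomorphism : (R : RawRing c ℓ) →
                     (RawRing.Carrier R → RawRing.Carrier R) → Set (c ⊔ ℓ)
IsRingAutomorphism R = MorphismStructures.RingMorphisms.IsRingIsomorphism R R

module Submission where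

-- Let R = GR(4^Δ), F = R/2 and q(u,v) = u² + 2uv. The value q(u,v) depends only on u and v
-- modulo 2, and q is a bijection from {u ≠ 0} × F to the units of R, because every element of F
-- is a square. The identities q(u,u+v) = -q(u,v) and q(u,v) - q(v,u) = q(u+v,v) show that the
-- values of q at the six bases of a plane of F over 𝔽₂ form a sixtuple; the remaining units
-- q(u,0) = u² and q(u,u) = 3u², together with 2u², form the triples. A basis determines its plane,
-- hence these sets partition the nonzero elements. Finally φ(q(u,v)) = q(φ(u),φ(v)) for every
-- automorphism φ, and ξ q(u,v) = q(σu,σv) where σ² = ξ, so the partition is invariant.

-- The formula for q comes from (u + v)² - v² = u² + 2uv. Squares in R depend only on residues
-- modulo 2, so each class w of F has a lifted square w². A plane {0, u, v, u + v} carries three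
-- nonzero lifted squares, and their six differences are the values of q at its bases; that two of
-- these differences add up to a third is a telescoping sum. The degenerate pairs v = 0 and v = u
-- give the differences u² and -u², the units of a triple.
--
-- The obstacle is that the argument needs inverses in F and decidable equality in R, whereas
-- equality in `GR h` is mere divisibility by h. Both come from one count: F has at most 2^Δ
-- classes, and 0 together with 2^Δ - 1 powers of ξ already gives that many distinct ones, so every
-- class is 0 or a power of ξ. The number of sixtuples results from listing the values of q at all
-- bases in two ways, by plane and by basis.

open import Defs
open import Algebra.Bundles using (CommutativeRing)
open import Algebra.Bundles.Raw using (RawRing)
import Algebra.Definitions.RawMagma as RawMagmaDefinitions
import Algebra.Definitions.RawSemiring as RawSemiringDefinitions
import Algebra.Morphism.Construct.Identity as Identity
open import Algebra.Morphism.Structures using (module RingMorphisms)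
import Algebra.Properties.AbelianGroup as AbelianGroupProperties
import Algebra.Properties.CommutativeSemigroup as CommutativeSemigroupProperties
import Algebra.Properties.CommutativeSemiring.Exp as CommutativeExp
import Algebra.Properties.Group as GroupProperties
import Algebra.Properties.Ring as RingProperties
import Algebra.Properties.Semiring.Exp as Exp
import Algebra.Properties.Semiring.Mult.TCOptimised as Multiples
import Algebra.Solver.Ring as RingSolver
open import Algebra.Solver.Ring.AlmostCommutativeRing using (fromCommutativeRing; _-Raw-AlmostCommutative⟶_)
open import Algebra.Structures using (IsCommutativeRing)
open import Data.Fin.Base as Fin using (Fin; zero; suc; toℕ)
import Data.Fin.Properties as Fin
open import Data.Integer.Base as ℤ using (ℤ; +_)
import Data.Integer.DivMod as ℤ
import Data.Integer.Properties as ℤ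
open import Data.List.Base
  using (List; []; _∷_; map; length; concatMap; cartesianProduct; allFin; deduplicate; lookup)
import Data.List.Membership.Propositional as ∈
import Data.List.Membership.Propositional.Properties as ∈
import Data.List.Membership.Setoid as SetoidMembership
import Data.List.Membership.Setoid.Properties as SetoidMembershipProperties
import Data.List.Properties as List
open import Data.List.Relation.Binary.Pointwise.Base using (Pointwise; []; _∷_)
open import Data.List.Relation.Unary.All as All using ([]; _∷_)
import Data.List.Relation.Unary.All.Properties as All
open import Data.List.Relation.Unary.AllPairs as AllPairs using (AllPairs; []; _∷_)
import Data.List.Relation.Unary.AllPairs.Properties as AllPairs
open import Data.List.Relation.Unary.Any as Any using (Any; here; there)
import Data.List.Relation.Unary.Any.Properties as Any
import Data.List.Relation.Unary.Unique.DecSetoid.Properties as DecUnique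
import Data.List.Relation.Unary.Unique.Propositional.Properties as PropUnique
import Data.List.Relation.Unary.Unique.Setoid as SetoidUnique
import Data.List.Relation.Unary.Unique.Setoid.Properties as Unique
import Data.Maybe.Base as Maybe
open import Data.Nat.Base as ℕ using (ℕ; zero; suc; _%_; _/_)
import Data.Nat.DivMod as ℕ
import Data.Nat.Properties as ℕ
open import Data.Product.Base as Product using (Σ-syntax; ∃-syntax; _×_; _,_; proj₁; proj₂)
open import Data.Sum.Base as Sum using (_⊎_; inj₁; inj₂; [_,_]′)
open import Function.Base using (_∘_; id; case_of_)
open import Level using (Level; 0ℓ; _⊔_)
open import Relation.Binary.Bundles using (Setoid; DecSetoid)
open import Relation.Binary.Core using (Rel)
open import Relation.Binary.Definitions using (tri<; tri≈; tri>)
open import Relation.Binary.PropositionalEquality.Core as ≡ using (_≡_; _≢_)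
import Relation.Binary.PropositionalEquality.Properties as ≡
import Relation.Binary.Reasoning.Setoid as SetoidReasoning
open import Relation.Binary.Structures using (IsEquivalence)
open import Relation.Nullary.Decidable.Core using (Dec; yes; no; dec⇒maybe)
open import Relation.Nullary.Negation.Core using (¬_; contradiction)
open import Relation.Unary using (Pred; _⊆_; _≐_)

private
  variable
    c ℓ : Level

-- Quotients of a commutative ring by a principal ideal

module Quotient (R : CommutativeRing c ℓ) (m : CommutativeRing.Carrier R) where
  open CommutativeRing R
  open RingProperties ring using (-‿distribˡ-*; -‿distribʳ-*)
  open AbelianGroupProperties +-abelianGroup using (⁻¹-∙-comm; ⁻¹-anti-homo‿-)
  open CommutativeSemigroupProperties +-commutativeSemigroup using (interchange)
  open RawMagmaDefinitions *-rawMagma using (_∣ʳ_; _,_)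
  open SetoidReasoning setoid

  infix 4 _≈ₘ_
  _≈ₘ_ : Carrier → Carrier → Set (c ⊔ ℓ)
  x ≈ₘ y = m ∣ʳ (x + - y)

  telescope : ∀ x y z → (x + - y) + (y + - z) ≈ x + - z
  telescope x y z = begin
    (x + - y) + (y + - z)  ≈⟨ +-assoc x (- y) (y + - z) ⟩
    x + (- y + (y + - z))  ≈⟨ +-congˡ (+-assoc (- y) y (- z)) ⟨
    x + ((- y + y) + - z)  ≈⟨ +-congˡ (+-congʳ (-‿inverseˡ y)) ⟩
    x + (0# + - z)         ≈⟨ +-congˡ (+-identityˡ (- z)) ⟩
    x + - z                ∎

  ≈⇒≈ₘ : ∀ {x y} → x ≈ y → x ≈ₘ y
  ≈⇒≈ₘ {x} {y} x≈y = 0# , (begin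
    0# * m   ≈⟨ zeroˡ m ⟩
    0#       ≈⟨ -‿inverseʳ y ⟨
    y + - y  ≈⟨ +-congʳ x≈y ⟨
    x + - y  ∎)

  shift : ∀ {x y} q → x ≈ y + q * m → x ≈ₘ y
  shift {x} {y} q x≈ = q , (begin
    q * m              ≈⟨ +-identityˡ (q * m) ⟨
    0# + q * m         ≈⟨ +-congʳ (-‿inverseˡ y) ⟨
    (- y + y) + q * m  ≈⟨ +-assoc (- y) y (q * m) ⟩
    - y + (y + q * m)  ≈⟨ +-congˡ x≈ ⟨
    - y + x            ≈⟨ +-comm (- y) x ⟩
    x + - y            ∎)

  unshift : ∀ {x y} → ((q , _) : x ≈ₘ y) → x ≈ y + q * m
  unshift {x} {y} (q , eq) = begin
    x                  ≈⟨ +-identityʳ x ⟨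
    x + 0#             ≈⟨ +-congˡ (-‿inverseˡ y) ⟨
    x + (- y + y)      ≈⟨ +-assoc x (- y) y ⟨
    (x + - y) + y      ≈⟨ +-congʳ eq ⟨
    q * m + y          ≈⟨ +-comm (q * m) y ⟩
    y + q * m          ∎

  symₘ : ∀ {x y} → x ≈ₘ y → y ≈ₘ x
  symₘ {x} {y} (q , eq) = - q , (begin
    - q * m    ≈⟨ -‿distribˡ-* q m ⟨
    - (q * m)  ≈⟨ -‿cong eq ⟩
    - (x - y)  ≈⟨ ⁻¹-anti-homo‿- x y ⟩
    y - x      ∎)

  transₘ : ∀ {x y z} → x ≈ₘ y → y ≈ₘ z → x ≈ₘ z
  transₘ {x} {y} {z} (q , eq) (r , eq′) = q + r , (begin
    (q + r) * m            ≈⟨ distribʳ m q r ⟩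
    q * m + r * m          ≈⟨ +-cong eq eq′ ⟩
    (x + - y) + (y + - z)  ≈⟨ telescope x y z ⟩
    x + - z                ∎)

  +-congₘ : ∀ {x y u v} → x ≈ₘ y → u ≈ₘ v → x + u ≈ₘ y + v
  +-congₘ {x} {y} {u} {v} (q , eq) (r , eq′) = q + r , (begin
    (q + r) * m            ≈⟨ distribʳ m q r ⟩
    q * m + r * m          ≈⟨ +-cong eq eq′ ⟩
    (x + - y) + (u + - v)  ≈⟨ interchange x (- y) u (- v) ⟩
    (x + u) + (- y + - v)  ≈⟨ +-congˡ (⁻¹-∙-comm y v) ⟩
    (x + u) + - (y + v)    ∎)

  *-congˡₘ : ∀ x {u v} → u ≈ₘ v → x * u ≈ₘ x * v
  *-congˡₘ x {u} {v} (q , eq) = x * q , (begin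
    (x * q) * m        ≈⟨ *-assoc x q m ⟩
    x * (q * m)        ≈⟨ *-congˡ eq ⟩
    x * (u + - v)      ≈⟨ distribˡ x u (- v) ⟩
    x * u + x * - v    ≈⟨ +-congˡ (-‿distribʳ-* x v) ⟨
    x * u + - (x * v)  ∎)

  *-congₘ : ∀ {x y u v} → x ≈ₘ y → u ≈ₘ v → x * u ≈ₘ y * v
  *-congₘ {x} {y} {u} {v} x≈y u≈v =
    transₘ (*-congˡₘ x u≈v)
      (transₘ (≈⇒≈ₘ (*-comm x v)) (transₘ (*-congˡₘ v x≈y) (≈⇒≈ₘ (*-comm v y))))

  -‿congₘ : ∀ {x y} → x ≈ₘ y → - x ≈ₘ - y
  -‿congₘ {x} {y} (q , eq) = - q , (begin
    - q * m    ≈⟨ -‿distribˡ-* q m ⟨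
    - (q * m)  ≈⟨ -‿cong eq ⟩
    - (x - y)  ≈⟨ ⁻¹-∙-comm x (- y) ⟨
    - x - - y  ∎)

  isEquivalenceₘ : IsEquivalence _≈ₘ_
  isEquivalenceₘ = record { refl = ≈⇒≈ₘ refl ; sym = symₘ ; trans = transₘ }

  isCommutativeRingₘ : IsCommutativeRing _≈ₘ_ _+_ _*_ -_ 0# 1#
  isCommutativeRingₘ = record
    { isRing = record
      { +-isAbelianGroup = record
        { isGroup = record
          { isMonoid = record
            { isSemigroup = record
              { isMagma = record { isEquivalence = isEquivalenceₘ ; ∙-cong = +-congₘ }
              ; assoc = λ x y z → ≈⇒≈ₘ (+-assoc x y z)
              }
            ; identity = (λ x → ≈⇒≈ₘ (+-identityˡ x)) , λ x → ≈⇒≈ₘ (+-identityʳ x)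
            }
          ; inverse = (λ x → ≈⇒≈ₘ (-‿inverseˡ x)) , λ x → ≈⇒≈ₘ (-‿inverseʳ x)
          ; ⁻¹-cong = -‿congₘ
          }
        ; comm = λ x y → ≈⇒≈ₘ (+-comm x y)
        }
      ; *-cong = *-congₘ
      ; *-assoc = λ x y z → ≈⇒≈ₘ (*-assoc x y z)
      ; *-identity = (λ x → ≈⇒≈ₘ (*-identityˡ x)) , λ x → ≈⇒≈ₘ (*-identityʳ x)
      ; distrib = (λ x y z → ≈⇒≈ₘ (distribˡ x y z)) , λ x y z → ≈⇒≈ₘ (distribʳ x y z)
      }
    ; *-comm = λ x y → ≈⇒≈ₘ (*-comm x y)
    }

  quotientRing : CommutativeRing c (c ⊔ ℓ)
  quotientRing = record { isCommutativeRing = isCommutativeRingₘ }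

-- The ring laws for coefficient lists

module PolynomialRing (K : CommutativeRing c ℓ) where
  open CommutativeRing K hiding (zero; _-_)
  open RingProperties ring using (-0#≈0#)
  open CommutativeSemigroupProperties +-commutativeSemigroup using (interchange; x∙yz≈y∙xz)
  open Polynomial rawRing
  open SetoidReasoning setoid

  private
    Poly : Set c
    Poly = List Carrier

  infix 4 _≋_
  -- The equality of Polynomial.rawRing, wrapped so that f and g can be inferred from f ≋ g.
  record _≋_ (f g : Poly) : Set ℓ where
    constructor pointwise
    field
      at : ∀ n → coeff f n ≈ coeff g n
  open _≋_

  scale : Carrier → Poly → Poly
  scale a = map (a *_)

  coeff-add : ∀ f g n → coeff (add f g) n ≈ coeff f n + coeff g n
  coeff-add []      g       n       = sym (+-identityˡ _)
  coeff-add (a ∷ f) []      n       = sym (+-identityʳ _)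
  coeff-add (a ∷ f) (b ∷ g) zero    = refl
  coeff-add (a ∷ f) (b ∷ g) (suc n) = coeff-add f g n

  coeff-scale : ∀ a f n → coeff (scale a f) n ≈ a * coeff f n
  coeff-scale a []      n       = sym (zeroʳ a)
  coeff-scale a (b ∷ f) zero    = refl
  coeff-scale a (b ∷ f) (suc n) = coeff-scale a f n

  coeff-neg : ∀ f n → coeff (map -_ f) n ≈ - coeff f n
  coeff-neg []      n       = sym -0#≈0#
  coeff-neg (b ∷ f) zero    = refl
  coeff-neg (b ∷ f) (suc n) = coeff-neg f n

  coeff-∷-cong : ∀ {a b f g} → a ≈ b → f ≋ g → (a ∷ f) ≋ (b ∷ g)
  coeff-∷-cong a≈b f≋g .at zero    = a≈b
  coeff-∷-cong a≈b f≋g .at (suc n) = at f≋g n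

  add-cong : ∀ {f f′ g g′} → f ≋ f′ → g ≋ g′ → add f g ≋ add f′ g′
  add-cong {f} {f′} {g} {g′} p q .at n = begin
    coeff (add f g) n        ≈⟨ coeff-add f g n ⟩
    coeff f n + coeff g n    ≈⟨ +-cong (at p n) (at q n) ⟩
    coeff f′ n + coeff g′ n  ≈⟨ coeff-add f′ g′ n ⟨
    coeff (add f′ g′) n      ∎

  scale-cong : ∀ {a b f g} → a ≈ b → f ≋ g → scale a f ≋ scale b g
  scale-cong {a} {b} {f} {g} a≈b f≋g .at n = begin
    coeff (scale a f) n  ≈⟨ coeff-scale a f n ⟩
    a * coeff f n        ≈⟨ *-cong a≈b (at f≋g n) ⟩
    b * coeff g n        ≈⟨ coeff-scale b g n ⟨
    coeff (scale b g) n  ∎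

  neg-cong : ∀ {f g} → f ≋ g → map -_ f ≋ map -_ g
  neg-cong {f} {g} f≋g .at n = begin
    coeff (map -_ f) n  ≈⟨ coeff-neg f n ⟩
    - coeff f n         ≈⟨ -‿cong (at f≋g n) ⟩
    - coeff g n         ≈⟨ coeff-neg g n ⟨
    coeff (map -_ g) n  ∎

  ≋-refl : ∀ {f} → f ≋ f
  ≋-refl .at n = refl

  ≋-sym : ∀ {f g} → f ≋ g → g ≋ f
  ≋-sym p .at n = sym (at p n)

  ≋-trans : ∀ {f g k} → f ≋ g → g ≋ k → f ≋ k
  ≋-trans p q .at n = trans (at p n) (at q n)

  add-assoc : ∀ f g k → add (add f g) k ≋ add f (add g k)
  add-assoc f g k .at n = begin
    coeff (add (add f g) k) n                ≈⟨ coeff-add (add f g) k n ⟩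
    coeff (add f g) n + coeff k n            ≈⟨ +-congʳ (coeff-add f g n) ⟩
    (coeff f n + coeff g n) + coeff k n      ≈⟨ +-assoc _ _ _ ⟩
    coeff f n + (coeff g n + coeff k n)      ≈⟨ +-congˡ (coeff-add g k n) ⟨
    coeff f n + coeff (add g k) n            ≈⟨ coeff-add f (add g k) n ⟨
    coeff (add f (add g k)) n                ∎

  add-comm : ∀ f g → add f g ≋ add g f
  add-comm f g .at n = begin
    coeff (add f g) n      ≈⟨ coeff-add f g n ⟩
    coeff f n + coeff g n  ≈⟨ +-comm _ _ ⟩
    coeff g n + coeff f n  ≈⟨ coeff-add g f n ⟨
    coeff (add g f) n      ∎

  add-identityʳ : ∀ f → add f [] ≋ f
  add-identityʳ [] .at n = refl
  add-identityʳ (a ∷ f) .at n = refl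

  add-inverseʳ : ∀ f → add f (map -_ f) ≋ []
  add-inverseʳ f .at n = begin
    coeff (add f (map -_ f)) n      ≈⟨ coeff-add f (map -_ f) n ⟩
    coeff f n + coeff (map -_ f) n  ≈⟨ +-congˡ (coeff-neg f n) ⟩
    coeff f n + - coeff f n         ≈⟨ -‿inverseʳ _ ⟩
    0#                              ∎

  add-interchange : ∀ e f g k → add (add e f) (add g k) ≋ add (add e g) (add f k)
  add-interchange e f g k .at n = begin
    coeff (add (add e f) (add g k)) n
      ≈⟨ coeff-add (add e f) (add g k) n ⟩
    coeff (add e f) n + coeff (add g k) n
      ≈⟨ +-cong (coeff-add e f n) (coeff-add g k n) ⟩
    (coeff e n + coeff f n) + (coeff g n + coeff k n)
      ≈⟨ interchange _ _ _ _ ⟩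
    (coeff e n + coeff g n) + (coeff f n + coeff k n)
      ≈⟨ +-cong (coeff-add e g n) (coeff-add f k n) ⟨
    coeff (add e g) n + coeff (add f k) n
      ≈⟨ coeff-add (add e g) (add f k) n ⟨
    coeff (add (add e g) (add f k)) n ∎

  0∷[]≋[] : (0# ∷ []) ≋ []
  0∷[]≋[] .at zero    = refl
  0∷[]≋[] .at (suc n) = refl

  0∷-add : ∀ f g → (0# ∷ add f g) ≋ add (0# ∷ f) (0# ∷ g)
  0∷-add f g .at zero    = sym (+-identityˡ 0#)
  0∷-add f g .at (suc n) = refl

  scale-zero : ∀ {a} f → a ≈ 0# → scale a f ≋ []
  scale-zero {a} f a≈0 .at n = begin
    coeff (scale a f) n  ≈⟨ coeff-scale a f n ⟩
    a * coeff f n        ≈⟨ *-congʳ a≈0 ⟩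
    0# * coeff f n       ≈⟨ zeroˡ _ ⟩
    0#                   ∎

  scale-one : ∀ f → scale 1# f ≋ f
  scale-one f .at n = trans (coeff-scale 1# f n) (*-identityˡ _)

  scale-add : ∀ a f g → scale a (add f g) ≋ add (scale a f) (scale a g)
  scale-add a f g .at n = begin
    coeff (scale a (add f g)) n                  ≈⟨ coeff-scale a (add f g) n ⟩
    a * coeff (add f g) n                        ≈⟨ *-congˡ (coeff-add f g n) ⟩
    a * (coeff f n + coeff g n)                  ≈⟨ distribˡ _ _ _ ⟩
    a * coeff f n + a * coeff g n                ≈⟨ +-cong (coeff-scale a f n) (coeff-scale a g n) ⟨
    coeff (scale a f) n + coeff (scale a g) n    ≈⟨ coeff-add (scale a f) (scale a g) n ⟨
    coeff (add (scale a f) (scale a g)) n        ∎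

  scale-+ : ∀ a b f → scale (a + b) f ≋ add (scale a f) (scale b f)
  scale-+ a b f .at n = begin
    coeff (scale (a + b) f) n                    ≈⟨ coeff-scale (a + b) f n ⟩
    (a + b) * coeff f n                          ≈⟨ distribʳ _ _ _ ⟩
    a * coeff f n + b * coeff f n                ≈⟨ +-cong (coeff-scale a f n) (coeff-scale b f n) ⟨
    coeff (scale a f) n + coeff (scale b f) n    ≈⟨ coeff-add (scale a f) (scale b f) n ⟨
    coeff (add (scale a f) (scale b f)) n        ∎

  scale-* : ∀ a b f → scale (a * b) f ≋ scale a (scale b f)
  scale-* a b f .at n = begin
    coeff (scale (a * b) f) n        ≈⟨ coeff-scale (a * b) f n ⟩
    (a * b) * coeff f n              ≈⟨ *-assoc _ _ _ ⟩
    a * (b * coeff f n)              ≈⟨ *-congˡ (coeff-scale b f n) ⟨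
    a * coeff (scale b f) n          ≈⟨ coeff-scale a (scale b f) n ⟨
    coeff (scale a (scale b f)) n    ∎

  mul-zeroʳ : ∀ f → mul f [] ≋ []
  mul-zeroʳ []      = ≋-refl
  mul-zeroʳ (a ∷ f) = ≋-trans (coeff-∷-cong refl (mul-zeroʳ f)) 0∷[]≋[]

  mul-vanishing : ∀ f g → f ≋ [] → mul f g ≋ []
  mul-vanishing []      g p = ≋-refl
  mul-vanishing (a ∷ f) g p =
    ≋-trans (add-cong (scale-zero g (at p zero))
                      (≋-trans (coeff-∷-cong refl (mul-vanishing f g (pointwise λ n → at p (suc n)))) 0∷[]≋[]))
            ≋-refl

  mul-congʳ : ∀ f {g g′} → g ≋ g′ → mul f g ≋ mul f g′
  mul-congʳ []      p = ≋-refl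
  mul-congʳ (a ∷ f) p = add-cong (scale-cong refl p) (coeff-∷-cong refl (mul-congʳ f p))

  mul-congˡ : ∀ f f′ g → f ≋ f′ → mul f g ≋ mul f′ g
  mul-congˡ []      f′       g p = ≋-sym (mul-vanishing f′ g (≋-sym p))
  mul-congˡ (a ∷ f) []       g p = mul-vanishing (a ∷ f) g p
  mul-congˡ (a ∷ f) (b ∷ f′) g p =
    add-cong (scale-cong {f = g} (at p zero) ≋-refl)
             (coeff-∷-cong refl (mul-congˡ f f′ g (pointwise λ n → at p (suc n))))

  mul-cong : ∀ {f f′ g g′} → f ≋ f′ → g ≋ g′ → mul f g ≋ mul f′ g′
  mul-cong {f} {f′} {g} p q = ≋-trans (mul-congˡ f f′ g p) (mul-congʳ f′ q)

  mul-distribʳ : ∀ k f g → mul (add f g) k ≋ add (mul f k) (mul g k)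
  mul-distribʳ k []      g       = ≋-refl
  mul-distribʳ k (a ∷ f) []      = ≋-sym (add-identityʳ _)
  mul-distribʳ k (a ∷ f) (b ∷ g) =
    ≋-trans (add-cong (scale-+ a b k)
                      (≋-trans (coeff-∷-cong refl (mul-distribʳ k f g)) (0∷-add (mul f k) (mul g k))))
            (add-interchange (scale a k) (scale b k) (0# ∷ mul f k) (0# ∷ mul g k))

  -- Since `mul` recurses on its left factor, this expansion along the right factor is what turns
  -- `mul-comm` into a plain induction. Commutativity of the coefficients enters here.
  mul-∷ʳ : ∀ f b g → mul f (b ∷ g) ≋ add (scale b f) (0# ∷ mul f g)
  mul-∷ʳ []      b g         = ≋-sym 0∷[]≋[]
  mul-∷ʳ (a ∷ f) b g .at zero    = +-cong (*-comm a b) refl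
  mul-∷ʳ (a ∷ f) b g .at (suc n) = begin
    coeff (add (scale a g) (mul f (b ∷ g))) n
      ≈⟨ coeff-add (scale a g) (mul f (b ∷ g)) n ⟩
    coeff (scale a g) n + coeff (mul f (b ∷ g)) n
      ≈⟨ +-congˡ (at (mul-∷ʳ f b g) n) ⟩
    coeff (scale a g) n + coeff (add (scale b f) (0# ∷ mul f g)) n
      ≈⟨ +-congˡ (coeff-add (scale b f) (0# ∷ mul f g) n) ⟩
    coeff (scale a g) n + (coeff (scale b f) n + coeff (0# ∷ mul f g) n)
      ≈⟨ x∙yz≈y∙xz _ _ _ ⟩
    coeff (scale b f) n + (coeff (scale a g) n + coeff (0# ∷ mul f g) n)
      ≈⟨ +-congˡ (coeff-add (scale a g) (0# ∷ mul f g) n) ⟨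
    coeff (scale b f) n + coeff (add (scale a g) (0# ∷ mul f g)) n
      ≈⟨ coeff-add (scale b f) (add (scale a g) (0# ∷ mul f g)) n ⟨
    coeff (add (scale b f) (add (scale a g) (0# ∷ mul f g))) n ∎

  mul-comm : ∀ f g → mul f g ≋ mul g f
  mul-comm []      g = ≋-sym (mul-zeroʳ g)
  mul-comm (a ∷ f) g =
    ≋-trans (add-cong {f = scale a g} ≋-refl (coeff-∷-cong refl (mul-comm f g))) (≋-sym (mul-∷ʳ g a f))

  scale-mul : ∀ a f g → mul (scale a f) g ≋ scale a (mul f g)
  scale-mul a []      g = ≋-refl
  scale-mul a (b ∷ f) g =
    ≋-trans (add-cong (scale-* a b g) (coeff-∷-cong (sym (zeroʳ a)) (scale-mul a f g)))
            (≋-sym (scale-add a (scale b g) (0# ∷ mul f g)))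

  0∷-mul : ∀ f g → mul (0# ∷ f) g ≋ (0# ∷ mul f g)
  0∷-mul f g = add-cong {f = scale 0# g} {f′ = []} (scale-zero g refl) ≋-refl

  mul-assoc : ∀ f g k → mul (mul f g) k ≋ mul f (mul g k)
  mul-assoc []      g k = ≋-refl
  mul-assoc (a ∷ f) g k =
    ≋-trans (mul-distribʳ k (scale a g) (0# ∷ mul f g))
            (add-cong (scale-mul a g k)
                      (≋-trans (0∷-mul (mul f g) k) (coeff-∷-cong refl (mul-assoc f g k))))

  mul-identityˡ : ∀ f → mul (1# ∷ []) f ≋ f
  mul-identityˡ f = ≋-trans (add-cong (scale-one f) 0∷[]≋[]) (add-identityʳ f)

  polynomialRing : CommutativeRing c ℓ
  polynomialRing = record
    { Carrier = Poly ; _≈_ = λ f g → ∀ n → coeff f n ≈ coeff g n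
    ; _+_ = add ; _*_ = mul ; -_ = map -_ ; 0# = [] ; 1# = 1# ∷ []
    ; isCommutativeRing = record
      { isRing = record
        { +-isAbelianGroup = record
          { isGroup = record
            { isMonoid = record
              { isSemigroup = record
                { isMagma = record
                  { isEquivalence = record
                    { refl = λ n → refl ; sym = λ p n → sym (p n) ; trans = λ p q n → trans (p n) (q n) }
                  ; ∙-cong = λ {f} {f′} {g} {g′} p q → at (add-cong {f} {f′} {g} {g′} (pointwise p) (pointwise q))
                  }
                ; assoc = λ f g k → at (add-assoc f g k)
                }
              ; identity = (λ f → at (≋-refl {f})) , λ f → at (add-identityʳ f)
              }
            ; inverse = (λ f → at (≋-trans (add-comm (map -_ f) f) (add-inverseʳ f))) , λ f → at (add-inverseʳ f)
            ; ⁻¹-cong = λ {f} {g} p → at (neg-cong {f} {g} (pointwise p))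
            }
          ; comm = λ f g → at (add-comm f g)
          }
        ; *-cong = λ {f} {f′} {g} {g′} p q → at (mul-cong {f} {f′} {g} {g′} (pointwise p) (pointwise q))
        ; *-assoc = λ f g k → at (mul-assoc f g k)
        ; *-identity = (λ f → at (mul-identityˡ f))
                     , λ f → at (≋-trans (mul-comm f (1# ∷ [])) (mul-identityˡ f))
        ; distrib = (λ f g k → at (≋-trans (mul-comm f (add g k))
                                    (≋-trans (mul-distribʳ f g k) (add-cong (mul-comm g f) (mul-comm k f)))))
                  , λ k f g → at (mul-distribʳ k f g)
        }
      ; *-comm = λ f g → at (mul-comm f g)
      }
    }

-- Division by a monic polynomial

module Monic (K : CommutativeRing c ℓ) (h : List (CommutativeRing.Carrier K)) (d : ℕ)
             (monic : Polynomial.MonicOfDegree (CommutativeRing.rawRing K) d h) where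
  open CommutativeRing K hiding (zero; _-_)
  open Polynomial rawRing
  open MonicOfDegree monic
  open PolynomialRing K
  open _≋_
  open SetoidReasoning setoid

  VanishesFrom : ℕ → List Carrier → Set ℓ
  VanishesFrom n f = ∀ {k} → n ℕ.≤ k → coeff f k ≈ 0#

  -- In degree m + d only the coefficient of degree m in q can meet the leading coefficient 1 of h;
  -- every other product involves a coefficient beyond one of the two bounds.
  mul-leading : ∀ q m → VanishesFrom (suc m) q → coeff (mul q h) (m ℕ.+ d) ≈ coeff q m
  mul-leading []      m       q-van = refl
  mul-leading (a ∷ q) zero    q-van = begin
    coeff (add (scale a h) (0# ∷ mul q h)) d    ≈⟨ coeff-add (scale a h) (0# ∷ mul q h) d ⟩
    coeff (scale a h) d + coeff (0# ∷ mul q h) d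
      ≈⟨ +-cong (trans (coeff-scale a h d) (*-congˡ leading))
                (at (≋-trans (coeff-∷-cong refl (mul-vanishing q h q≋[])) 0∷[]≋[]) d) ⟩
    a * 1# + 0#                                 ≈⟨ +-identityʳ _ ⟩
    a * 1#                                      ≈⟨ *-identityʳ a ⟩
    a                                           ∎
    where
    q≋[] : q ≋ []
    q≋[] = pointwise λ n → q-van (ℕ.s≤s ℕ.z≤n)
  mul-leading (a ∷ q) (suc m) q-van = begin
    coeff (add (scale a h) (0# ∷ mul q h)) (suc (m ℕ.+ d))
      ≈⟨ coeff-add (scale a h) (0# ∷ mul q h) (suc (m ℕ.+ d)) ⟩
    coeff (scale a h) (suc (m ℕ.+ d)) + coeff (mul q h) (m ℕ.+ d)
      ≈⟨ +-cong (trans (coeff-scale a h (suc (m ℕ.+ d))) (*-congˡ (above (ℕ.s≤s (ℕ.m≤n+m d m)))))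
                (mul-leading q m (q-van ∘ ℕ.s≤s)) ⟩
    a * 0# + coeff q m    ≈⟨ +-congʳ (zeroʳ a) ⟩
    0# + coeff q m        ≈⟨ +-identityˡ _ ⟩
    coeff q m             ∎

  vanishesFrom-length : ∀ q → VanishesFrom (length q) q
  vanishesFrom-length []      _            = refl
  vanishesFrom-length (a ∷ q) (ℕ.s≤s n≤k) = vanishesFrom-length q n≤k

  -- Descent on a bound for the degree of q, starting from its length: the top coefficient of q
  -- reappears in the product by `mul-leading`, in a degree where the product vanishes. Monicity of
  -- h makes this work over coefficients with zero divisors, such as ℤ₄.
  multiple-of-low-degree : ∀ q → VanishesFrom d (mul q h) → q ≋ []
  multiple-of-low-degree q qh-van = pointwise λ n → descend (length q) (vanishesFrom-length q) ℕ.z≤n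
    where
    descend : ∀ n → VanishesFrom n q → VanishesFrom 0 q
    descend zero    q-van = q-van
    descend (suc n) q-van = descend n λ {k} n≤k → case-≤ n≤k (ℕ.m≤n⇒m<n∨m≡n n≤k)
      where
      case-≤ : ∀ {k} → n ℕ.≤ k → n ℕ.< k ⊎ n ≡ k → coeff q k ≈ 0#
      case-≤ _ (inj₁ n<k)     = q-van n<k
      case-≤ _ (inj₂ ≡.refl) = trans (sym (mul-leading q n q-van)) (qh-van (ℕ.m≤n+m d n))

  record Division (f : List Carrier) : Set (c ⊔ ℓ) where
    field
      quotient remainder : List Carrier
      equation : f ≋ add remainder (mul quotient h)
      lowDegree : VanishesFrom d remainder

  -- Horner's scheme: if f = g + q h, then a + X f = (a + X g) + X q h. The new remainder a + X g
  -- may have a coefficient b in degree d, which is removed by subtracting b h, and b becomes the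
  -- constant term of the new quotient.
  divide : ∀ f → Division f
  divide []      = record
    { quotient = [] ; remainder = [] ; equation = ≋-refl ; lowDegree = λ _ → refl }
  divide (a ∷ f) = record
    { quotient = b ∷ q ; remainder = g′ ; equation = pointwise equation′ ; lowDegree = low }
    where
    open Division (divide f) renaming (quotient to q; remainder to g)
    b : Carrier
    b = coeff (a ∷ g) d
    g′ : List Carrier
    g′ = add (a ∷ g) (map -_ (scale b h))
    coeff-g′ : ∀ n → coeff g′ n ≈ coeff (a ∷ g) n + - (b * coeff h n)
    coeff-g′ n = begin
      coeff g′ n                                           ≈⟨ coeff-add (a ∷ g) (map -_ (scale b h)) n ⟩
      coeff (a ∷ g) n + coeff (map -_ (scale b h)) n       ≈⟨ +-congˡ (coeff-neg (scale b h) n) ⟩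
      coeff (a ∷ g) n + - coeff (scale b h) n              ≈⟨ +-congˡ (-‿cong (coeff-scale b h n)) ⟩
      coeff (a ∷ g) n + - (b * coeff h n)                  ∎
    a∷f≋ : (a ∷ f) ≋ add (a ∷ g) (0# ∷ mul q h)
    a∷f≋ .at zero    = sym (+-identityʳ a)
    a∷f≋ .at (suc n) = at equation n
    equation′ : ∀ n → coeff (a ∷ f) n ≈ coeff (add g′ (add (scale b h) (0# ∷ mul q h))) n
    equation′ n = sym (begin
      coeff (add g′ (add (scale b h) r)) n
        ≈⟨ coeff-add g′ (add (scale b h) r) n ⟩
      coeff g′ n + coeff (add (scale b h) r) n
        ≈⟨ +-cong (coeff-g′ n) (trans (coeff-add (scale b h) r n) (+-congʳ (coeff-scale b h n))) ⟩
      (x + - y) + (y + z)  ≈⟨ +-assoc x (- y) (y + z) ⟩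
      x + (- y + (y + z))  ≈⟨ +-congˡ (+-assoc (- y) y z) ⟨
      x + ((- y + y) + z)  ≈⟨ +-congˡ (+-congʳ (-‿inverseˡ y)) ⟩
      x + (0# + z)         ≈⟨ +-congˡ (+-identityˡ z) ⟩
      x + z                ≈⟨ coeff-add (a ∷ g) r n ⟨
      coeff (add (a ∷ g) r) n  ≈⟨ at a∷f≋ n ⟨
      coeff (a ∷ f) n      ∎)
      where
      r : List Carrier
      r = 0# ∷ mul q h
      x y z : Carrier
      x = coeff (a ∷ g) n
      y = b * coeff h n
      z = coeff r n
    low : VanishesFrom d g′
    low {k} d≤k with ℕ.m≤n⇒m<n∨m≡n d≤k
    ... | inj₂ ≡.refl = begin
      coeff g′ d              ≈⟨ coeff-g′ d ⟩
      b + - (b * coeff h d)   ≈⟨ +-congˡ (-‿cong (trans (*-congˡ leading) (*-identityʳ b))) ⟩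
      b + - b                 ≈⟨ -‿inverseʳ b ⟩
      0#                      ∎
    ... | inj₁ (ℕ.s≤s {n = k′} d≤k′) = begin
      coeff g′ (suc k′)                        ≈⟨ coeff-g′ (suc k′) ⟩
      coeff g k′ + - (b * coeff h (suc k′))
        ≈⟨ +-cong (lowDegree d≤k′) (-‿cong (trans (*-congˡ (above (ℕ.s≤s d≤k′))) (zeroʳ b))) ⟩
      0# + - 0#                                ≈⟨ -‿inverseʳ 0# ⟩
      0#                                       ∎

-- Powers of an element of maximal order exhaust the nonzero elements

module PowersExhaust (F : CommutativeRing c ℓ) where
  open CommutativeRing F

  -- The function code witnesses that F has at most t + 1 elements.
  module Bounded
    (1≉0 : ¬ 1# ≈ 0#) (ξ : Carrier) (t : ℕ) (ξ-order : HasOrder rawRing ξ t)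
    (code : Carrier → Fin (suc t)) (code-injective : ∀ {x y} → code x ≡ code y → x ≈ y) where

    open Exp semiring using (_^_; ^-homo-*)
    open HasOrder ξ-order
    open SetoidReasoning setoid

    ^-inverse : ∀ {k} → k ℕ.≤ t → ξ ^ k * ξ ^ (t ℕ.∸ k) ≈ 1#
    ^-inverse {k} k≤t = begin
      ξ ^ k * ξ ^ (t ℕ.∸ k)    ≈⟨ ^-homo-* ξ k (t ℕ.∸ k) ⟨
      ξ ^ (k ℕ.+ (t ℕ.∸ k))    ≡⟨ ≡.cong (ξ ^_) (ℕ.m+[n∸m]≡n k≤t) ⟩
      ξ ^ t                    ≈⟨ power ⟩
      1#                       ∎

    ^-nonzero : (k : Fin t) → ¬ ξ ^ toℕ k ≈ 0#
    ^-nonzero k ξᵏ≈0 = 1≉0 (begin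
      1#                                ≈⟨ ^-inverse (ℕ.<⇒≤ (Fin.toℕ<n k)) ⟨
      ξ ^ toℕ k * ξ ^ (t ℕ.∸ toℕ k)     ≈⟨ *-congʳ ξᵏ≈0 ⟩
      0# * ξ ^ (t ℕ.∸ toℕ k)            ≈⟨ zeroˡ _ ⟩
      0#                                ∎)

    -- Multiplying by `ξ ^ (t ∸ i)`, the inverse of `ξ ^ i`, turns an equality into `ξ ^ (j ∸ i)`
    -- being 1, against the minimality of t.
    ^-distinct : ∀ {i j} → i ℕ.< j → j ℕ.< t → ¬ ξ ^ i ≈ ξ ^ j
    ^-distinct {i} {j} i<j j<t ξⁱ≈ξʲ =
      minimal (ℕ.m<n⇒0<n∸m i<j) (ℕ.≤-<-trans (ℕ.m∸n≤m j i) j<t) (begin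
        ξ ^ (j ℕ.∸ i)                                      ≈⟨ *-identityˡ _ ⟨
        1# * ξ ^ (j ℕ.∸ i)                                 ≈⟨ *-congʳ (trans (*-comm _ _) (^-inverse i≤t)) ⟨
        (ξ ^ (t ℕ.∸ i) * ξ ^ i) * ξ ^ (j ℕ.∸ i)            ≈⟨ *-assoc _ _ _ ⟩
        ξ ^ (t ℕ.∸ i) * (ξ ^ i * ξ ^ (j ℕ.∸ i))            ≈⟨ *-congˡ (^-homo-* ξ i (j ℕ.∸ i)) ⟨
        ξ ^ (t ℕ.∸ i) * ξ ^ (i ℕ.+ (j ℕ.∸ i))
          ≡⟨ ≡.cong (λ k → ξ ^ (t ℕ.∸ i) * ξ ^ k) (ℕ.m+[n∸m]≡n (ℕ.<⇒≤ i<j)) ⟩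
        ξ ^ (t ℕ.∸ i) * ξ ^ j                              ≈⟨ *-congˡ ξⁱ≈ξʲ ⟨
        ξ ^ (t ℕ.∸ i) * ξ ^ i                              ≈⟨ trans (*-comm _ _) (^-inverse i≤t) ⟩
        1#                                                 ∎)
      where
      i≤t : i ℕ.≤ t
      i≤t = ℕ.<⇒≤ (ℕ.<-trans i<j j<t)

    ^-injective : (i j : Fin t) → ξ ^ toℕ i ≈ ξ ^ toℕ j → i ≡ j
    ^-injective i j eq with Fin.<-cmp i j
    ... | tri< i<j _ _ = contradiction eq (^-distinct i<j (Fin.toℕ<n j))
    ... | tri≈ _ i≡j _ = i≡j
    ... | tri> _ _ j<i = contradiction (sym eq) (^-distinct j<i (Fin.toℕ<n i))

    -- Pigeonhole: the t + 2 elements x, 0, ξ⁰, ..., ξᵗ⁻¹ share t + 1 codes. All but the first are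
    -- pairwise distinct, so the collision involves x.
    0-or-power : ∀ x → x ≈ 0# ⊎ ∃[ k ] x ≈ ξ ^ toℕ {t} k
    0-or-power x = collision (Fin.pigeonhole (ℕ.n<1+n (suc t)) (code ∘ element))
      where
      element : Fin (suc (suc t)) → Carrier
      element zero          = x
      element (suc zero)    = 0#
      element (suc (suc k)) = ξ ^ toℕ k

      collision : ∃[ i ] ∃[ j ] (i Fin.< j × code (element i) ≡ code (element j)) →
                  x ≈ 0# ⊎ ∃[ k ] x ≈ ξ ^ toℕ k
      collision (zero        , zero        , () , _)
      collision (zero        , suc zero    , _ , eq) = inj₁ (code-injective eq)
      collision (zero        , suc (suc k) , _ , eq) = inj₂ (k , code-injective eq)
      collision (suc zero    , zero        , () , _)
      collision (suc zero    , suc zero    , ℕ.s≤s () , _)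
      collision (suc zero    , suc (suc k) , _ , eq) = contradiction (sym (code-injective eq)) (^-nonzero k)
      collision (suc (suc i) , suc zero    , ℕ.s≤s () , _)
      collision (suc (suc i) , suc (suc j) , ℕ.s≤s (ℕ.s≤s i<j) , eq) =
        contradiction (code-injective eq) (^-distinct i<j (Fin.toℕ<n j))

-- Counting with duplicate-free lists

length-cartesianProduct : ∀ {a b} {A : Set a} {B : Set b} (xs : List A) (ys : List B) →
                          length (cartesianProduct xs ys) ≡ length xs ℕ.* length ys
length-cartesianProduct []       ys = ≡.refl
length-cartesianProduct (x ∷ xs) ys = ≡.trans (List.length-++ (map (x ,_) ys))
  (≡.cong₂ ℕ._+_ (List.length-map (x ,_) ys) (length-cartesianProduct xs ys))

allPairs-lookup : ∀ {a r} {A : Set a} {R : Rel A r} {xs} → AllPairs R xs →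
                  ∀ {i j} → i Fin.< j → R (lookup xs i) (lookup xs j)
allPairs-lookup (x∉xs ∷ xs!) {zero}  {suc j} _         = All.lookup x∉xs (∈.∈-lookup j)
allPairs-lookup (x∉xs ∷ xs!) {suc i} {suc j} (ℕ.s≤s i<j) = allPairs-lookup xs! i<j

punchIn-injective₂ : ∀ {n} {i i′ : Fin (suc n)} {j j′ : Fin n} → i ≡ i′ →
                     Fin.punchIn i j ≡ Fin.punchIn i′ j′ → (i , j) ≡ (i′ , j′)
punchIn-injective₂ {i = i} ≡.refl eq = ≡.cong (i ,_) (Fin.punchIn-injective i _ _ eq)

module _ (S : Setoid c ℓ) where
  open Setoid S using (_≈_; sym; trans)
  open SetoidMembership S using (_∈_)

  unique-lookup-injective : ∀ {xs} → SetoidUnique.Unique S xs → ∀ {i j} → lookup xs i ≈ lookup xs j → i ≡ j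
  unique-lookup-injective xs! {i} {j} eq with Fin.<-cmp i j
  ... | tri< i<j _ _ = contradiction eq (allPairs-lookup xs! i<j)
  ... | tri≈ _ i≡j _ = i≡j
  ... | tri> _ _ j<i = contradiction (sym eq) (allPairs-lookup xs! j<i)

  -- The position in ys of each entry of xs gives an injection between the index sets. Applied in
  -- both directions, it shows that two duplicate-free lists with the same members have equal
  -- length.
  unique-length-≤ : ∀ {xs ys} → SetoidUnique.Unique S xs → (∀ {x} → x ∈ xs → x ∈ ys) → length xs ℕ.≤ length ys
  unique-length-≤ {xs} {ys} xs! xs⊆ys = Fin.injective⇒≤ {f = Any.index ∘ position}
    λ {i} {j} eq → unique-lookup-injective xs!
      (SetoidMembershipProperties.index-injective S (position i) (position j) eq)
    where
    position : ∀ i → lookup xs i ∈ ys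
    position i = xs⊆ys (SetoidMembershipProperties.∈-lookup S xs i)


-- Calculation in rings with 4 = 0

FourVanishes : CommutativeRing c ℓ → Set ℓ
FourVanishes R = (1# + 1#) + (1# + 1#) ≈ 0#
  where open CommutativeRing R

-- Taking coefficients in ℤ/4 lets the ring solver use 4 ≈ 0.
module CharacteristicFour
  (R : CommutativeRing c ℓ) (4≈0 : FourVanishes R) where
  open CommutativeRing R
  open Multiples semiring using (×-homo-+; ×1-homo-*) renaming (_×_ to _·_)
  open AbelianGroupProperties +-abelianGroup using (inverseʳ-unique)
  open SetoidReasoning setoid

  4×1≈0 : 4 · 1# ≈ 0#
  4×1≈0 = trans (+-assoc (1# + 1#) 1# 1#) 4≈0

  multiple-of-4 : ∀ k → (k ℕ.* 4) · 1# ≈ 0#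
  multiple-of-4 k = begin
    (k ℕ.* 4) · 1#        ≈⟨ ×1-homo-* k 4 ⟩
    (k · 1#) * (4 · 1#)   ≈⟨ *-congˡ 4×1≈0 ⟩
    (k · 1#) * 0#         ≈⟨ zeroʳ _ ⟩
    0#                    ∎

  %4-× : ∀ k → (k % 4) · 1# ≈ k · 1#
  %4-× k = begin
    (k % 4) · 1#                              ≈⟨ +-identityʳ _ ⟨
    (k % 4) · 1# + 0#                         ≈⟨ +-congˡ (multiple-of-4 (k / 4)) ⟨
    (k % 4) · 1# + ((k / 4) ℕ.* 4) · 1#       ≈⟨ ×-homo-+ 1# (k % 4) ((k / 4) ℕ.* 4) ⟨
    (k % 4 ℕ.+ (k / 4) ℕ.* 4) · 1#            ≡⟨ ≡.cong (_· 1#) (ℕ.m≡m%n+[m/n]*n k 4) ⟨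
    k · 1#                                    ∎

  ℤ/4-coefficients : RawRing 0ℓ 0ℓ
  ℤ/4-coefficients = record
    { Carrier = ℕ ; _≈_ = _≡_
    ; _+_ = λ a b → (a ℕ.+ b) % 4 ; _*_ = λ a b → (a ℕ.* b) % 4 ; -_ = λ a → (a ℕ.* 3) % 4
    ; 0# = 0 ; 1# = 1
    }

  negate : ∀ a → ((a ℕ.* 3) % 4) · 1# ≈ - (a · 1#)
  negate a = inverseʳ-unique (a · 1#) (((a ℕ.* 3) % 4) · 1#) (begin
    a · 1# + ((a ℕ.* 3) % 4) · 1#   ≈⟨ +-congˡ (%4-× (a ℕ.* 3)) ⟩
    a · 1# + (a ℕ.* 3) · 1#         ≈⟨ ×-homo-+ 1# a (a ℕ.* 3) ⟨
    (a ℕ.+ a ℕ.* 3) · 1#            ≡⟨ ≡.cong (_· 1#) (ℕ.*-suc a 3) ⟨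
    (a ℕ.* 4) · 1#                  ≈⟨ multiple-of-4 a ⟩
    0#                              ∎)

  evaluation : ℤ/4-coefficients -Raw-AlmostCommutative⟶ fromCommutativeRing R
  evaluation = record
    { ⟦_⟧    = _· 1#
    ; +-homo = λ a b → trans (%4-× (a ℕ.+ b)) (×-homo-+ 1# a b)
    ; *-homo = λ a b → trans (%4-× (a ℕ.* b)) (×1-homo-* a b)
    ; -‿homo = negate
    ; 0-homo = refl
    ; 1-homo = refl
    }

  open RingSolver ℤ/4-coefficients (fromCommutativeRing R) evaluation
    (λ a b → Maybe.map (reflexive ∘ ≡.cong (_· 1#)) (dec⇒maybe (a ℕ.≟ b))) public
    using (solve; con; _:=_; _:+_; _:*_; :-_) renaming (Polynomial to Expression)

-- Reduction modulo 2 and the map q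

module LiftedSquares
  (R : CommutativeRing c ℓ) (4≈0 : FourVanishes R) where
  open CommutativeRing R
  open CharacteristicFour R 4≈0

  two : Carrier
  two = 1# + 1#

  open Exp semiring using (_^_)

  module F = Quotient R two
  open F public using (_≈ₘ_; shift; unshift) renaming (≈⇒≈ₘ to ≈⇒≈₂)
  private
    module F₂ = CommutativeRing F.quotientRing
    module ≈-Reasoning = SetoidReasoning setoid
    module ≈₂-Reasoning = SetoidReasoning F₂.setoid

  infix 4 _≈₂_
  _≈₂_ : Carrier → Carrier → Set _
  _≈₂_ = _≈ₘ_

  -- When u is a unit this is u²(1 + 2v/u), the decomposition of a unit of a Galois ring into a
  -- Teichmüller representative and a unit congruent to 1 modulo 2.
  q : Carrier → Carrier → Carrier
  q u v = u * u + two * (u * v)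

  decompose : ∀ {x y} → x ≈₂ y → ∃[ z ] x ≈ y + z * two
  decompose x≈y = _ , unshift x≈y

  -- Replacing u by u + 2a and v by v + 2b changes u² and 2uv only by multiples of 4.
  q-cong : ∀ {u u′ v v′} → u ≈₂ u′ → v ≈₂ v′ → q u v ≈ q u′ v′
  q-cong {u} {u′} {v} {v′} u≈u′ v≈v′ with decompose u≈u′ | decompose v≈v′
  ... | a , u≈ | b , v≈ = begin
    q u v                                 ≈⟨ +-cong (*-cong u≈ u≈) (*-congˡ (*-cong u≈ v≈)) ⟩
    q (u′ + a * two) (v′ + b * two)
      ≈⟨ solve 4 (λ u v a b → let u′ = u :+ a :* con 2 ; v′ = v :+ b :* con 2 in
           u′ :* u′ :+ con 2 :* (u′ :* v′) := u :* u :+ con 2 :* (u :* v)) refl u′ v′ a b ⟩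
    q u′ v′                               ∎
    where open ≈-Reasoning

  two-*-cong : ∀ {x y} → x ≈₂ y → two * x ≈ two * y
  two-*-cong {x} {y} x≈y with decompose x≈y
  ... | z , x≈ = begin
    two * x                ≈⟨ *-congˡ x≈ ⟩
    two * (y + z * two)    ≈⟨ solve 2 (λ y z → con 2 :* (y :+ z :* con 2) := con 2 :* y) refl y z ⟩
    two * y                ∎
    where open ≈-Reasoning

  square-cong : ∀ {u v} → u ≈₂ v → u * u ≈ v * v
  square-cong {u} {v} u≈v with decompose u≈v
  ... | z , u≈ = begin
    u * u                               ≈⟨ *-cong u≈ u≈ ⟩
    (v + z * two) * (v + z * two)
      ≈⟨ solve 2 (λ v z → (v :+ z :* con 2) :* (v :+ z :* con 2) := v :* v) refl v z ⟩
    v * v                               ∎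
    where open ≈-Reasoning

  q≈₂square : ∀ u v → q u v ≈₂ u * u
  q≈₂square u v = shift (u * v) (+-congˡ (*-comm two (u * v)))

  two-*≈₂0 : ∀ x → two * x ≈₂ 0#
  two-*≈₂0 x = shift x (trans (*-comm two x) (sym (+-identityˡ _)))

  -‿≈₂ : ∀ x → - x ≈₂ x
  -‿≈₂ x = shift x (solve 1 (λ x → :- x := x :+ x :* con 2) refl x)

  double≈₂0 : ∀ x → x + x ≈₂ 0#
  double≈₂0 x = shift x (solve 1 (λ x → x :+ x := con 0 :+ x :* con 2) refl x)

  sum≈₂0⇒≈₂ : ∀ {x y} → x + y ≈₂ 0# → x ≈₂ y
  sum≈₂0⇒≈₂ {x} {y} x+y≈0 = begin
    x             ≈⟨ shift (- y) (solve 2 (λ x y → x := ((x :+ y) :+ y) :+ :- y :* con 2) refl x y) ⟩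
    (x + y) + y   ≈⟨ F₂.+-congʳ x+y≈0 ⟩
    0# + y        ≈⟨ F₂.+-identityˡ y ⟩
    y             ∎
    where open ≈₂-Reasoning

  ≈₂⇒sum≈₂0 : ∀ {x y} → x ≈₂ y → x + y ≈₂ 0#
  ≈₂⇒sum≈₂0 {x} {y} x≈y = F₂.trans (F₂.+-congʳ x≈y) (double≈₂0 y)

  -- Doubling is well defined on residues modulo 2, so 1 = 0 in F would give 2 = 0 in R.
  nontrivial-mod-2 : ¬ two ≈ 0# → ¬ 1# ≈₂ 0#
  nontrivial-mod-2 2≉0 1≈0 = 2≉0 (begin
    two         ≈⟨ *-identityʳ two ⟨
    two * 1#    ≈⟨ two-*-cong 1≈0 ⟩
    two * 0#    ≈⟨ zeroʳ two ⟩
    0#          ∎)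
    where open ≈-Reasoning

  -- The residue field, enumerated by the powers of ξ

  module Enumerated
    (2≉0 : ¬ two ≈ 0#) (ξ : Carrier) (n : ℕ) (ξ^[1+n]≈1 : ξ ^ suc n ≈ 1#)
    (0-or-power : ∀ x → x ≈₂ 0# ⊎ ∃[ k ] x ≈₂ ξ ^ toℕ {suc n} k)
    (power-injective : (i j : Fin (suc n)) → ξ ^ toℕ i ≈₂ ξ ^ toℕ j → i ≡ j)
    (σ : Carrier) (σ²≈ξ : σ * σ ≈ ξ)
    where
    open Exp semiring using (^-homo-*; ^-congˡ)
    open CommutativeExp commutativeSemiring using (^-distrib-*)
    open RingProperties ring using (-‿distribʳ-*)
    open GroupProperties +-group using (⁻¹-involutive; x∙y⁻¹≈ε⇒x≈y)

    e : Fin (suc n) → Carrier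
    e k = ξ ^ toℕ k

    1≉₂0 : ¬ 1# ≈₂ 0#
    1≉₂0 = nontrivial-mod-2 2≉0

    e-inverse : ∀ k → ∃[ y ] e k * y ≈ 1#
    e-inverse k = ξ ^ (suc n ℕ.∸ toℕ k) , (begin
      e k * ξ ^ (suc n ℕ.∸ toℕ k)           ≈⟨ ^-homo-* ξ (toℕ k) (suc n ℕ.∸ toℕ k) ⟨
      ξ ^ (toℕ k ℕ.+ (suc n ℕ.∸ toℕ k))     ≡⟨ ≡.cong (ξ ^_) (ℕ.m+[n∸m]≡n (ℕ.<⇒≤ (Fin.toℕ<n k))) ⟩
      ξ ^ suc n                             ≈⟨ ξ^[1+n]≈1 ⟩
      1#                                    ∎)
      where open ≈-Reasoning

    inverse : ∀ {x} → ¬ x ≈₂ 0# → ∃[ y ] x * y ≈₂ 1#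
    inverse {x} x≉0 with 0-or-power x
    ... | inj₁ x≈0          = contradiction x≈0 x≉0
    ... | inj₂ (k , x≈eₖ) with e-inverse k
    ...   | y , eₖy≈1       = y , F₂.trans (F₂.*-congʳ x≈eₖ) (≈⇒≈₂ eₖy≈1)

    cancel : ∀ {x y} → ¬ x ≈₂ 0# → x * y ≈₂ 0# → y ≈₂ 0#
    cancel {x} {y} x≉0 xy≈0 with inverse x≉0
    ... | z , xz≈1 = begin
      y              ≈⟨ F₂.*-identityˡ y ⟨
      1# * y         ≈⟨ F₂.*-congʳ xz≈1 ⟨
      (x * z) * y    ≈⟨ ≈⇒≈₂ (solve 3 (λ x y z → (x :* z) :* y := z :* (x :* y)) refl x y z) ⟩
      z * (x * y)    ≈⟨ F₂.*-congˡ xy≈0 ⟩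
      z * 0#         ≈⟨ F₂.zeroʳ z ⟩
      0#             ∎
      where open ≈₂-Reasoning

    *-≉₂0 : ∀ {x y} → ¬ x ≈₂ 0# → ¬ y ≈₂ 0# → ¬ x * y ≈₂ 0#
    *-≉₂0 x≉0 y≉0 xy≈0 = y≉0 (cancel x≉0 xy≈0)

    unit≉₂0 : ∀ {x y} → x * y ≈₂ 1# → ¬ x ≈₂ 0#
    unit≉₂0 {x} {y} xy≈1 x≈0 = 1≉₂0 (F₂.trans (F₂.sym xy≈1) (F₂.trans (F₂.*-congʳ x≈0) (F₂.zeroˡ y)))

    e≉₂0 : ∀ k → ¬ e k ≈₂ 0#
    e≉₂0 k = unit≉₂0 (≈⇒≈₂ (proj₂ (e-inverse k)))

    -- Otherwise x is congruent modulo 2 to a power of ξ, which is a unit of R, and cancelling that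
    -- unit from 2x = 0 leaves 2 = 0. Thus doubling identifies F with 2R.
    two-cancel : ∀ {x} → two * x ≈ 0# → x ≈₂ 0#
    two-cancel {x} 2x≈0 with 0-or-power x
    ... | inj₁ x≈0         = x≈0
    ... | inj₂ (k , x≈eₖ) with e-inverse k
    ...   | y , eₖy≈1      = contradiction (begin
      two                ≈⟨ *-identityʳ two ⟨
      two * 1#           ≈⟨ *-congˡ eₖy≈1 ⟨
      two * (e k * y)    ≈⟨ *-assoc two (e k) y ⟨
      (two * e k) * y    ≈⟨ *-congʳ (two-*-cong x≈eₖ) ⟨
      (two * x) * y      ≈⟨ *-congʳ 2x≈0 ⟩
      0# * y             ≈⟨ zeroˡ y ⟩
      0#                 ∎) 2≉0
      where open ≈-Reasoning

    two-*-injective : ∀ {x y} → two * x ≈ two * y → x ≈₂ y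
    two-*-injective {x} {y} 2x≈2y = sum≈₂0⇒≈₂ (two-cancel (begin
      two * (x + y)        ≈⟨ distribˡ two x y ⟩
      two * x + two * y    ≈⟨ +-congʳ 2x≈2y ⟩
      two * y + two * y    ≈⟨ solve 1 (λ y → con 2 :* y :+ con 2 :* y := con 0) refl y ⟩
      0#                   ∎))
      where open ≈-Reasoning

    -- Frobenius modulo 2: x² + y² is (x + y)², and a class with square zero is zero.
    square-injective : ∀ {x y} → x * x ≈₂ y * y → x ≈₂ y
    square-injective {x} {y} x²≈y² = sum≈₂0⇒≈₂ sum≈0
      where
      open ≈₂-Reasoning
      sum²≈0 : (x + y) * (x + y) ≈₂ 0#
      sum²≈0 = begin
        (x + y) * (x + y)    ≈⟨ shift (x * y) (solve 2 (λ x y → (x :+ y) :* (x :+ y) :=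
                                  (x :* x :+ y :* y) :+ (x :* y) :* con 2) refl x y) ⟩
        x * x + y * y        ≈⟨ ≈₂⇒sum≈₂0 x²≈y² ⟩
        0#                   ∎
      sum≈0 : x + y ≈₂ 0#
      sum≈0 with 0-or-power (x + y)
      ... | inj₁ s≈0        = s≈0
      ... | inj₂ (k , s≈eₖ) = cancel (λ s≈0 → e≉₂0 k (F₂.trans (F₂.sym s≈eₖ) s≈0)) sum²≈0

    _≟₂0 : ∀ x → Dec (x ≈₂ 0#)
    x ≟₂0 with 0-or-power x
    ... | inj₁ x≈0        = yes x≈0
    ... | inj₂ (k , x≈eₖ) = no λ x≈0 → e≉₂0 k (F₂.trans (F₂.sym x≈eₖ) x≈0)

    power : ∀ {x} → ¬ x ≈₂ 0# → ∃[ k ] x ≈₂ e k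
    power {x} x≉0 with 0-or-power x
    ... | inj₁ x≈0 = contradiction x≈0 x≉0
    ... | inj₂ p   = p

    -- The test has two levels: x must be some 2z, and by `two-cancel` and `two-*-cong` such an
    -- element vanishes exactly when z is zero modulo 2.
    _≟0 : ∀ x → Dec (x ≈ 0#)
    x ≟0 with x ≟₂0
    ... | no x≉₂0  = no λ x≈0 → x≉₂0 (≈⇒≈₂ x≈0)
    ... | yes x≈₂0 with decompose x≈₂0
    ...   | z , x≈ with z ≟₂0
    ...     | yes z≈0 = yes (begin
      x                ≈⟨ x≈ ⟩
      0# + z * two     ≈⟨ solve 1 (λ z → con 0 :+ z :* con 2 := con 2 :* z) refl z ⟩
      two * z          ≈⟨ two-*-cong z≈0 ⟩
      two * 0#         ≈⟨ zeroʳ two ⟩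
      0#               ∎)
      where open ≈-Reasoning
    ...     | no z≉0  = no λ x≈0 → z≉0 (two-cancel (begin
      two * z          ≈⟨ solve 1 (λ z → con 0 :+ z :* con 2 := con 2 :* z) refl z ⟨
      0# + z * two     ≈⟨ x≈ ⟨
      x                ≈⟨ x≈0 ⟩
      0#               ∎))
      where open ≈-Reasoning

    -- Modulo 2 the value is u², which determines u. The difference of the two values is then 2u(v +
    -- v′), since signs do not matter after doubling, and both 2 and u cancel.
    q-injective : ∀ {u v u′ v′} → ¬ u ≈₂ 0# → q u v ≈ q u′ v′ → u ≈₂ u′ × v ≈₂ v′
    q-injective {u} {v} {u′} {v′} u≉0 q≈q′ = u≈u′ , sum≈₂0⇒≈₂ (cancel u≉0 (two-cancel (begin
        two * (u * (v + v′))
          ≈⟨ solve 3 (λ u v v′ → con 2 :* (u :* (v :+ v′)) :=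
               (u :* u :+ con 2 :* (u :* v)) :+ :- (u :* u :+ con 2 :* (u :* v′))) refl u v v′ ⟩
        q u v + - q u v′         ≈⟨ +-congʳ (trans q≈q′ (q-cong (F₂.sym u≈u′) F₂.refl)) ⟩
        q u v′ + - q u v′        ≈⟨ -‿inverseʳ _ ⟩
        0#                       ∎)))
      where
      open ≈-Reasoning
      u≈u′ : u ≈₂ u′
      u≈u′ = square-injective (F₂.trans (F₂.sym (q≈₂square u v)) (F₂.trans (≈⇒≈₂ q≈q′) (q≈₂square u′ v′)))

    q≉₂0 : ∀ {u} v → ¬ u ≈₂ 0# → ¬ q u v ≈₂ 0#
    q≉₂0 {u} v u≉0 q≈0 = *-≉₂0 u≉0 u≉0 (F₂.trans (F₂.sym (q≈₂square u v)) q≈0)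

    -- Sixtuples attached to planes

    open Cells rawRing

    six : Carrier → Carrier → List Carrier
    six a b = a ∷ - a ∷ b ∷ - b ∷ (a + b) ∷ - (a + b) ∷ []

    Elements-resp : ∀ {xs x y} → x ≈ y → Elements xs x → Elements xs y
    Elements-resp x≈y = Any.map (trans (sym x≈y))

    pattern 1st p = here p
    pattern 2nd p = there (here p)
    pattern 3rd p = there (there (here p))
    pattern 4th p = there (there (there (here p)))
    pattern 5th p = there (there (there (there (here p))))
    pattern 6th p = there (there (there (there (there (here p)))))

    six-neg : ∀ {a b x} → Elements (six a b) x → Elements (six a b) (- x)
    six-neg (1st p) = 2nd (-‿cong p)
    six-neg (2nd p) = 1st (trans (-‿cong p) (⁻¹-involutive _))
    six-neg (3rd p) = 4th (-‿cong p)
    six-neg (4th p) = 3rd (trans (-‿cong p) (⁻¹-involutive _))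
    six-neg (5th p) = 6th (-‿cong p)
    six-neg (6th p) = 5th (trans (-‿cong p) (⁻¹-involutive _))

    six-⊆ : ∀ {a b a′ b′} → Elements (six a′ b′) a → Elements (six a′ b′) b → Elements (six a′ b′) (a + b) →
            Elements (six a b) ⊆ Elements (six a′ b′)
    six-⊆ a∈ b∈ c∈ (1st p) = Elements-resp (sym p) a∈
    six-⊆ a∈ b∈ c∈ (2nd p) = Elements-resp (sym p) (six-neg a∈)
    six-⊆ a∈ b∈ c∈ (3rd p) = Elements-resp (sym p) b∈
    six-⊆ a∈ b∈ c∈ (4th p) = Elements-resp (sym p) (six-neg b∈)
    six-⊆ a∈ b∈ c∈ (5th p) = Elements-resp (sym p) c∈
    six-⊆ a∈ b∈ c∈ (6th p) = Elements-resp (sym p) (six-neg c∈)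

    -- Modulo 2 the list collapses to a, b, a + b, each taken twice. These three classes are
    -- distinct, which separates entries from different pairs; inside a pair, x = -x would mean 2x =
    -- 0.
    six-distinct : ∀ {a b} → ¬ a ≈₂ 0# → ¬ b ≈₂ 0# → ¬ a ≈₂ b → AllPairs _≉_ (six a b)
    six-distinct {a} {b} a≉0 b≉0 a≉b =
      (≉- a≉0 ∷ distinct a≉b ∷ distinctʳ a≉b ∷ distinct a≉c ∷ distinctʳ a≉c ∷ []) ∷
      (distinctˡ a≉b ∷ distinctˡʳ a≉b ∷ distinctˡ a≉c ∷ distinctˡʳ a≉c ∷ []) ∷
      (≉- b≉0 ∷ distinct b≉c ∷ distinctʳ b≉c ∷ []) ∷
      (distinctˡ b≉c ∷ distinctˡʳ b≉c ∷ []) ∷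
      (≉- (λ c≈0 → a≉b (sum≈₂0⇒≈₂ c≈0)) ∷ []) ∷
      [] ∷ []
      where
      a≉c : ¬ a ≈₂ a + b
      a≉c a≈c = b≉0 (F₂.trans (shift (- a) (solve 2 (λ a b → b := (a :+ (a :+ b)) :+ :- a :* con 2) refl a b))
                              (≈₂⇒sum≈₂0 a≈c))
      b≉c : ¬ b ≈₂ a + b
      b≉c b≈c = a≉0 (F₂.trans (shift (- b) (solve 2 (λ a b → a := (b :+ (a :+ b)) :+ :- b :* con 2) refl a b))
                              (≈₂⇒sum≈₂0 b≈c))
      ≉- : ∀ {x} → ¬ x ≈₂ 0# → x ≉ - x
      ≉- {x} x≉0 x≈-x = x≉0 (two-cancel (begin
        two * x      ≈⟨ solve 1 (λ x → con 2 :* x := x :+ x) refl x ⟩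
        x + x        ≈⟨ +-congˡ x≈-x ⟩
        x + - x      ≈⟨ -‿inverseʳ x ⟩
        0#           ∎))
        where open ≈-Reasoning
      distinct : ∀ {x y} → ¬ x ≈₂ y → x ≉ y
      distinct x≉y x≈y = x≉y (≈⇒≈₂ x≈y)
      distinctʳ : ∀ {x y} → ¬ x ≈₂ y → x ≉ - y
      distinctʳ x≉y x≈y = x≉y (F₂.trans (≈⇒≈₂ x≈y) (-‿≈₂ _))
      distinctˡ : ∀ {x y} → ¬ x ≈₂ y → - x ≉ y
      distinctˡ x≉y x≈y = x≉y (F₂.trans (F₂.sym (-‿≈₂ _)) (≈⇒≈₂ x≈y))
      distinctˡʳ : ∀ {x y} → ¬ x ≈₂ y → - x ≉ - y
      distinctˡʳ x≉y x≈y = x≉y (F₂.trans (F₂.sym (-‿≈₂ _)) (F₂.trans (≈⇒≈₂ x≈y) (-‿≈₂ _)))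

    -- With A = u², B = v² and C = (u + v)², the generators are C - B and A - C. The minus sign
    -- orients the second difference so that their sum is A - B, again a difference of lifted
    -- squares.
    sixtuple : Carrier → Carrier → List Carrier
    sixtuple u v = six (q u v) (- q v u)

    sixtuple-cong : ∀ {u u′ v v′} → u ≈₂ u′ → v ≈₂ v′ → Elements (sixtuple u v) ≐ Elements (sixtuple u′ v′)
    sixtuple-cong u≈ v≈ = half u≈ v≈ , half (F₂.sym u≈) (F₂.sym v≈)
      where
      half : ∀ {u u′ v v′} → u ≈₂ u′ → v ≈₂ v′ → Elements (sixtuple u v) ⊆ Elements (sixtuple u′ v′)
      half u≈ v≈ = six-⊆ (1st a≈) (3rd b≈) (5th (+-cong a≈ b≈))
        where
        a≈ = q-cong u≈ v≈
        b≈ = -‿cong (q-cong v≈ u≈)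

    -- Swap and shear generate GL(2, 𝔽₂), which acts transitively on the ordered bases of a plane.
    -- Invariance under these two moves therefore makes the sixtuple a function of the plane alone.
    sixtuple-swap : ∀ u v → Elements (sixtuple u v) ≐ Elements (sixtuple v u)
    sixtuple-swap u v = half u v , half v u
      where
      half : ∀ u v → Elements (sixtuple u v) ⊆ Elements (sixtuple v u)
      half u v = six-⊆
        (4th (sym (⁻¹-involutive _)))
        (2nd refl)
        (6th (solve 2 (λ a b → a :+ :- b := :- (b :+ :- a)) refl (q u v) (q v u)))

    -- The shear exchanges the lifted squares v² and (u + v)², because u + (u + v) is congruent to v
    -- modulo 2.
    sixtuple-shear : ∀ u v → Elements (sixtuple u v) ≐ Elements (sixtuple u (u + v))
    sixtuple-shear u v =
        six-⊆
          (2nd (solve 2 (λ u v → Q u v := :- Q u (u :+ v)) refl u v))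
          (5th (solve 2 (λ u v → :- Q v u := Q u (u :+ v) :+ :- Q (u :+ v) u) refl u v))
          (3rd (solve 2 (λ u v → Q u v :+ :- Q v u := :- Q (u :+ v) u) refl u v))
      , six-⊆
          (2nd (solve 2 (λ u v → Q u (u :+ v) := :- Q u v) refl u v))
          (5th (solve 2 (λ u v → :- Q (u :+ v) u := Q u v :+ :- Q v u) refl u v))
          (3rd (solve 2 (λ u v → Q u (u :+ v) :+ :- Q (u :+ v) u := :- Q v u) refl u v))
      where
      Q : ∀ {k} → Expression k → Expression k → Expression k
      Q u v = u :* u :+ con 2 :* (u :* v)

    -- Linear independence over 𝔽₂, whose only scalars are 0 and 1.
    Independent : Carrier → Carrier → Set _
    Independent u v = ¬ u ≈₂ 0# × ¬ v ≈₂ 0# × ¬ u ≈₂ v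

    independent-swap : ∀ {u v} → Independent u v → Independent v u
    independent-swap (u≉0 , v≉0 , u≉v) = v≉0 , u≉0 , u≉v ∘ F₂.sym

    independent-shear : ∀ {u v} → Independent u v → Independent u (u + v)
    independent-shear {u} {v} (u≉0 , v≉0 , u≉v) = u≉0 , u≉v ∘ sum≈₂0⇒≈₂ , λ u≈u+v → v≉0 (begin
      v              ≈⟨ shift (- u) (solve 2 (λ u v → v := (u :+ (u :+ v)) :+ :- u :* con 2) refl u v) ⟩
      u + (u + v)    ≈⟨ ≈₂⇒sum≈₂0 u≈u+v ⟩
      0#             ∎)
      where open ≈₂-Reasoning

    ≐-trans : ∀ {a p q r} {A : Set a} {P : Pred A p} {Q : Pred A q} {T : Pred A r} → P ≐ Q → Q ≐ T → P ≐ T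
    ≐-trans (f , g) (f′ , g′) = f′ ∘ f , g ∘ g′

    ≐-sym : ∀ {a p q} {A : Set a} {P : Pred A p} {Q : Pred A q} → P ≐ Q → Q ≐ P
    ≐-sym (f , g) = g , f

    -- A basis at which q takes the value x, spanning the same plane as u and v. Equality of planes
    -- is expressed by equality of their sixtuples, so subspaces never have to be formed.
    record Basis (u v x : Carrier) : Set (c ⊔ ℓ) where
      constructor mkBasis
      field
        u′ v′       : Carrier
        independent : Independent u′ v′
        x≈q         : x ≈ q u′ v′
        samePlane   : Elements (sixtuple u v) ≐ Elements (sixtuple u′ v′)

    -- The six entries correspond to the six ordered bases: negating the value at (u, v) amounts to
    -- the shear to (u, u + v), and each remaining basis is reached by a word in swap and shear.
    basis : ∀ {u v x} → Independent u v → Elements (sixtuple u v) x → Basis u v x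
    basis {u} {v} ind (1st p) = mkBasis u v ind p (id , id)
    basis {u} {v} ind (2nd p) = mkBasis u (u + v) (independent-shear ind)
      (trans p (solve 2 (λ u v → :- (u :* u :+ con 2 :* (u :* v)) := u :* u :+ con 2 :* (u :* (u :+ v))) refl u v))
      (sixtuple-shear u v)
    basis {u} {v} ind (3rd p) = mkBasis v (v + u) (independent-shear (independent-swap ind))
      (trans p (solve 2 (λ u v → :- (u :* u :+ con 2 :* (u :* v)) := u :* u :+ con 2 :* (u :* (u :+ v))) refl v u))
      (≐-trans (sixtuple-swap u v) (sixtuple-shear v u))
    basis {u} {v} ind (4th p) =
      mkBasis v u (independent-swap ind) (trans p (⁻¹-involutive _)) (sixtuple-swap u v)
    basis {u} {v} ind (5th p) = mkBasis (v + u) v (independent-swap (independent-shear (independent-swap ind)))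
      (trans p (solve 2 (λ u v → (u :* u :+ con 2 :* (u :* v)) :+ :- (v :* v :+ con 2 :* (v :* u)) :=
                                 (v :+ u) :* (v :+ u) :+ con 2 :* ((v :+ u) :* v)) refl u v))
      (≐-trans (sixtuple-swap u v) (≐-trans (sixtuple-shear v u) (sixtuple-swap v (v + u))))
    basis {u} {v} ind (6th p) = mkBasis (u + v) u (independent-swap (independent-shear ind))
      (trans p (solve 2 (λ u v → :- ((u :* u :+ con 2 :* (u :* v)) :+ :- (v :* v :+ con 2 :* (v :* u))) :=
                                 (u :+ v) :* (u :+ v) :+ con 2 :* ((u :+ v) :* u)) refl u v))
      (≐-trans (sixtuple-shear u v) (sixtuple-swap u (u + v)))

    bases-agree : ∀ {u v u′ v′ x} → Basis u v x → Basis u′ v′ x →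
                  Elements (sixtuple u v) ≐ Elements (sixtuple u′ v′)
    bases-agree (mkBasis a b (a≉0 , _) x≈ same) (mkBasis a′ b′ _ x≈′ same′) =
      let a≈a′ , b≈b′ = q-injective a≉0 (trans (sym x≈) x≈′)
      in ≐-trans same (≐-trans (sixtuple-cong a≈a′ b≈b′) (≐-sym same′))

    sixtuples-meet : ∀ {u v u′ v′ x} → Independent u v → Independent u′ v′ →
                     Elements (sixtuple u v) x → Elements (sixtuple u′ v′) x →
                     Elements (sixtuple u v) ≐ Elements (sixtuple u′ v′)
    sixtuples-meet ind ind′ x∈ x∈′ = bases-agree (basis ind x∈) (basis ind′ x∈′)

    sixtuple-distinct : ∀ {u v} → Independent u v → AllPairs _≉_ (sixtuple u v)
    sixtuple-distinct {u} {v} (u≉0 , v≉0 , u≉v) = six-distinct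
      (q≉₂0 v u≉0)
      (λ b≈0 → q≉₂0 u v≉0 (F₂.trans (F₂.sym (-‿≈₂ _)) b≈0))
      (λ a≈b → u≉v (square-injective (F₂.trans (F₂.sym (q≈₂square u v))
        (F₂.trans a≈b (F₂.trans (-‿≈₂ _) (q≈₂square v u))))))

    -- Enumerating bases and counting planes

    Pair : Set
    Pair = Fin (suc n) × Fin n

    -- `Fin.punchIn i` skips the index i, so a pair encodes an ordered pair of distinct powers of ξ.
    -- Over 𝔽₂ these are exactly the ordered bases of planes, each listed once.
    fst snd : Pair → Carrier
    fst (i , j) = e i
    snd (i , j) = e (Fin.punchIn i j)

    line : Pair → List Carrier
    line p = sixtuple (fst p) (snd p)

    point : Pair → Carrier
    point p = q (fst p) (snd p)

    pair-independent : ∀ p → Independent (fst p) (snd p)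
    pair-independent (i , j) = e≉₂0 i , e≉₂0 (Fin.punchIn i j) ,
      λ eq → Fin.punchInᵢ≢i i j (≡.sym (power-injective i (Fin.punchIn i j) eq))

    locate : ∀ {u v} → Independent u v → ∃[ p ] (u ≈₂ fst p × v ≈₂ snd p)
    locate {u} {v} (u≉0 , v≉0 , u≉v) with power u≉0 | power v≉0
    ... | i , u≈ | k , v≈ = (i , Fin.punchOut i≢k) , u≈ ,
      F₂.trans v≈ (F₂.reflexive (≡.cong e (≡.sym (Fin.punchIn-punchOut i≢k))))
      where
      i≢k : i ≡.≢ k
      i≢k ≡.refl = u≉v (F₂.trans u≈ (F₂.sym v≈))

    point-injective : ∀ {p p′} → point p ≈ point p′ → p ≡ p′
    point-injective {i , j} {i′ , j′} eq =
      let eᵢ≈ , eⱼ≈ = q-injective {e i} {e (Fin.punchIn i j)} {e i′} {e (Fin.punchIn i′ j′)} (e≉₂0 i) eq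
      in punchIn-injective₂ (power-injective i i′ eᵢ≈) (power-injective _ _ eⱼ≈)

    infix 4 _∼_
    -- The relation of spanning the same plane. Testing a single value is enough because sixtuples
    -- that meet coincide, and it makes the relation decidable.
    _∼_ : Pair → Pair → Set _
    p ∼ p′ = Elements (line p) (point p′)

    ∼⇒≐ : ∀ {p p′} → p ∼ p′ → Elements (line p) ≐ Elements (line p′)
    ∼⇒≐ {p} {p′} p∼p′ = sixtuples-meet (pair-independent p) (pair-independent p′) p∼p′ (here refl)

    meet⇒∼ : ∀ {p p′ x} → Elements (line p) x → Elements (line p′) x → p ∼ p′
    meet⇒∼ {p} {p′} x∈ x∈′ = proj₂ (sixtuples-meet (pair-independent p) (pair-independent p′) x∈ x∈′) (here refl)

    ∼-decSetoid : DecSetoid 0ℓ _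
    ∼-decSetoid = record
      { Carrier = Pair
      ; _≈_ = _∼_
      ; isDecEquivalence = record
        { isEquivalence = record
          { refl  = here refl
          ; sym   = λ {p} {p′} p∼p′ → meet⇒∼ {p′} {p} (here refl) p∼p′
          ; trans = λ {p} {p′} {p″} p∼p′ p′∼p″ → proj₂ (∼⇒≐ {p} {p′} p∼p′) p′∼p″
          }
        ; _≟_ = λ p p′ → Any.any? (point p′ ≟_) (line p)
        }
      }
      where
      _≟_ : ∀ x y → Dec (x ≈ y)
      x ≟ y with (x + - y) ≟0
      ... | yes x-y≈0 = yes (x∙y⁻¹≈ε⇒x≈y x y x-y≈0)
      ... | no  x-y≉0 = no λ x≈y → x-y≉0 (trans (+-congʳ x≈y) (-‿inverseʳ y))

    open DecSetoid ∼-decSetoid using () renaming (_≟_ to _∼?_; sym to ∼-sym)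

    -- Deduplication leaves one chosen basis for each plane.
    pairs lines : List Pair
    pairs = cartesianProduct (allFin (suc n)) (allFin n)
    lines = deduplicate _∼?_ pairs

    ∈-pairs : ∀ p → p ∈.∈ pairs
    ∈-pairs (i , j) = ∈.∈-cartesianProduct⁺ (∈.∈-allFin i) (∈.∈-allFin j)

    lines! : AllPairs (λ p p′ → ¬ p ∼ p′) lines
    lines! = DecUnique.deduplicate-! ∼-decSetoid pairs

    ∈-lines : ∀ p → Any (_∼ p) lines
    ∈-lines p = Any.deduplicate⁺ _∼?_ (λ {r} {r′} r′∼r r∼p → DecSetoid.trans ∼-decSetoid {r′} {r} {p} r′∼r r∼p)
                  (Any.map (λ { ≡.refl → here refl }) (∈-pairs p))

    length-concatMap-line : ∀ ps → length (concatMap line ps) ≡ length ps ℕ.* 6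
    length-concatMap-line []       = ≡.refl
    length-concatMap-line (p ∷ ps) = ≡.cong (6 ℕ.+_) (length-concatMap-line ps)

    length-pairs : length pairs ≡ suc n ℕ.* n
    length-pairs = ≡.trans (length-cartesianProduct (allFin (suc n)) (allFin n))
      (≡.cong₂ ℕ._*_ (List.length-tabulate {n = suc n} id) (List.length-tabulate {n = n} id))

    basis∈points : ∀ {u v x} → Basis u v x → Elements (map point pairs) x
    basis∈points b = value∈points (locate (Basis.independent b))
      where
      value∈points : ∃[ p ] (Basis.u′ b ≈₂ fst p × Basis.v′ b ≈₂ snd p) → Elements (map point pairs) _
      value∈points (p , u≈ , v≈) = Any.map⁺ (Any.map (λ { ≡.refl → trans (Basis.x≈q b) (q-cong u≈ v≈) }) (∈-pairs p))

    line⊆points : ∀ {x} → ∃[ p ] Elements (line p) x → Elements (map point pairs) x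
    line⊆points (p , x∈p) = basis∈points (basis (pair-independent p) x∈p)

    point∈lines : ∀ {x} → ∃[ p ] x ≈ point p → Elements (concatMap line lines) x
    point∈lines (p , x≈) = Any.concatMap⁺ line {xs = lines} (Any.map (Elements-resp (sym x≈)) (∈-lines p))

    -- Double counting of the values of q at bases: grouped by plane there are six for each line,
    -- listed by basis there is one for each pair. Both lists are free of duplicates and have the
    -- same members.
    length-lines : length lines ℕ.* 6 ≡ suc n ℕ.* n
    length-lines = begin
      length lines ℕ.* 6                ≡⟨ length-concatMap-line lines ⟨
      length (concatMap line lines)     ≡⟨ ℕ.≤-antisym (unique-length-≤ setoid elements! elements⊆points)
                                                       (unique-length-≤ setoid points! points⊆elements) ⟩
      length (map point pairs)          ≡⟨ List.length-map point pairs ⟩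
      length pairs                      ≡⟨ length-pairs ⟩
      suc n ℕ.* n                       ∎
      where
      open ≡.≡-Reasoning
      disjoint-lines : ∀ {p p′} → ¬ p ∼ p′ → ∀ {x} → ¬ (Elements (line p) x × Elements (line p′) x)
      disjoint-lines {p} {p′} p≁p′ (x∈ , x∈′) = p≁p′ (meet⇒∼ {p} {p′} x∈ x∈′)
      elements! : SetoidUnique.Unique setoid (concatMap line lines)
      elements! = Unique.concat⁺ setoid
        (All.map⁺ (All.universal (λ p → sixtuple-distinct (pair-independent p)) lines))
        (AllPairs.map⁺ (AllPairs.map (λ {p} {p′} p≁p′ {_} → disjoint-lines {p} {p′} p≁p′) lines!))
      points! : SetoidUnique.Unique setoid (map point pairs)
      points! = Unique.map⁺ (≡.setoid Pair) setoid (λ {p} {p′} → point-injective {p} {p′})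
        (PropUnique.cartesianProduct⁺ (PropUnique.allFin⁺ (suc n)) (PropUnique.allFin⁺ n))
      elements⊆points : ∀ {x} → Elements (concatMap line lines) x → Elements (map point pairs) x
      elements⊆points x∈ = line⊆points (Any.satisfied (Any.concatMap⁻ line {xs = lines} x∈))
      points⊆elements : ∀ {x} → Elements (map point pairs) x → Elements (concatMap line lines) x
      points⊆elements x∈ = point∈lines (Any.satisfied (Any.map⁻ x∈))

    -- Square roots and triples

    square-root : ∀ k → ∃[ s ] s * s ≈ e k
    square-root k = σ ^ toℕ k , (begin
      σ ^ toℕ k * σ ^ toℕ k    ≈⟨ ^-distrib-* σ σ (toℕ k) ⟨
      (σ * σ) ^ toℕ k          ≈⟨ ^-congˡ (toℕ k) σ²≈ξ ⟩
      ξ ^ toℕ k                ∎)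
      where open ≈-Reasoning

    -- The root `σ ^ k` of a power of ξ is traded for the power of ξ in its own residue class, which
    -- has the same square by `square-cong`.
    square : ∀ {x} → ¬ x ≈₂ 0# → ∃[ i ] x ≈₂ e i * e i
    square {x} x≉0 with power x≉0
    ... | k , x≈eₖ with square-root k
    ...   | s , s²≈eₖ with power {s} (λ s≈0 → e≉₂0 k (F₂.trans (≈⇒≈₂ (sym s²≈eₖ))
                                                         (F₂.trans (F₂.*-congʳ s≈0) (F₂.zeroˡ s))))
    ...     | i , s≈eᵢ = i , F₂.trans x≈eₖ (≈⇒≈₂ (trans (sym s²≈eₖ) (square-cong s≈eᵢ)))

    -- The sums are spelled out as `2 · a` and `3 · a` unfold, so that `isTriple` holds with
    -- identity inclusions.
    triple : Carrier → List Carrier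
    triple a = a ∷ a + (a + 0#) ∷ a + (a + (a + 0#)) ∷ []

    triple-distinct : ∀ {a} → ¬ a ≈₂ 0# → AllPairs _≉_ (triple a)
    triple-distinct {a} a≉0 =
      ((λ eq → a≉0 (≈⇒≈₂ (begin
          a                          ≈⟨ solve 1 (λ a → a := (a :+ (a :+ con 0)) :+ :- a) refl a ⟩
          (a + (a + 0#)) + - a       ≈⟨ +-congʳ eq ⟨
          a + - a                    ≈⟨ -‿inverseʳ a ⟩
          0#                         ∎)))
        ∷ (λ eq → a≉0 (two-cancel (begin
          two * a
            ≈⟨ solve 1 (λ a → con 2 :* a := (a :+ (a :+ (a :+ con 0))) :+ :- a) refl a ⟩
          (a + (a + (a + 0#))) + - a       ≈⟨ +-congʳ eq ⟨
          a + - a                          ≈⟨ -‿inverseʳ a ⟩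
          0#                               ∎)))
        ∷ []) ∷
      ((λ eq → a≉0 (≈⇒≈₂ (begin
          a
            ≈⟨ solve 1 (λ a → a := (a :+ (a :+ (a :+ con 0))) :+ :- (a :+ (a :+ con 0))) refl a ⟩
          (a + (a + (a + 0#))) + - (a + (a + 0#))    ≈⟨ +-congʳ eq ⟨
          (a + (a + 0#)) + - (a + (a + 0#))          ≈⟨ -‿inverseʳ _ ⟩
          0#                                         ∎)))
        ∷ []) ∷
      [] ∷ []
      where open ≈-Reasoning

    -- The two units of a triple are treated alike, as values of q at a pair that fails to be a
    -- basis: v = 0 gives u², v = u gives 3u².
    data TripleElement (u x : Carrier) : Set (c ⊔ ℓ) where
      odd  : ∀ v → v ≈₂ 0# ⊎ v ≈₂ u → x ≈ q u v → TripleElement u x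
      even : x ≈ two * (u * u) → TripleElement u x

    triple-element : ∀ {u x} → Elements (triple (u * u)) x → TripleElement u x
    triple-element {u} (1st p) = odd 0# (inj₁ F₂.refl)
      (trans p (solve 1 (λ u → u :* u := u :* u :+ con 2 :* (u :* con 0)) refl u))
    triple-element {u} (2nd p) = even (trans p (solve 1 (λ a → a :+ (a :+ con 0) := con 2 :* a) refl (u * u)))
    triple-element {u} (3rd p) = odd u (inj₂ F₂.refl)
      (trans p (solve 1 (λ u → u :* u :+ (u :* u :+ (u :* u :+ con 0)) := u :* u :+ con 2 :* (u :* u)) refl u))

    triple-nonzero : ∀ {u x} → ¬ u ≈₂ 0# → TripleElement u x → ¬ x ≈ 0#
    triple-nonzero u≉0 (odd v _ x≈q) x≈0 = q≉₂0 v u≉0 (≈⇒≈₂ (trans (sym x≈q) x≈0))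
    triple-nonzero u≉0 (even x≈2u²)  x≈0 = *-≉₂0 u≉0 u≉0 (two-cancel (trans (sym x≈2u²) x≈0))

    triple-determines : ∀ {u u′ x} → ¬ u ≈₂ 0# → ¬ u′ ≈₂ 0# → TripleElement u x → TripleElement u′ x → u ≈₂ u′
    triple-determines u≉0 u′≉0 (odd v _ x≈) (odd v′ _ x≈′) = proj₁ (q-injective u≉0 (trans (sym x≈) x≈′))
    triple-determines u≉0 u′≉0 (odd v _ x≈) (even x≈′)     =
      contradiction (F₂.trans (≈⇒≈₂ (trans (sym x≈) x≈′)) (two-*≈₂0 _)) (q≉₂0 v u≉0)
    triple-determines u≉0 u′≉0 (even x≈)    (odd v′ _ x≈′) =
      contradiction (F₂.trans (≈⇒≈₂ (trans (sym x≈′) x≈)) (two-*≈₂0 _)) (q≉₂0 v′ u′≉0)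
    triple-determines u≉0 u′≉0 (even x≈)    (even x≈′)     =
      square-injective (two-*-injective (trans (sym x≈) x≈′))

    -- The element 2u² is zero modulo 2, unlike every value in a sixtuple. For a unit, q determines
    -- the pair of residues, which would have to be degenerate and independent at once.
    triple-not-sixtuple : ∀ {t u v x} → ¬ t ≈₂ 0# → TripleElement t x → ¬ Basis u v x
    triple-not-sixtuple t≉0 (even x≈) (mkBasis _ v′ (u′≉0 , _) x≈′ _) =
      q≉₂0 v′ u′≉0 (F₂.trans (≈⇒≈₂ (trans (sym x≈′) x≈)) (two-*≈₂0 _))
    triple-not-sixtuple t≉0 (odd w w≈ x≈) (mkBasis _ _ (_ , v′≉0 , u′≉v′) x≈′ _) =
      let t≈u′ , w≈v′ = q-injective t≉0 (trans (sym x≈) x≈′)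
      in case w≈ of λ where
        (inj₁ w≈0) → v′≉0 (F₂.trans (F₂.sym w≈v′) w≈0)
        (inj₂ w≈t) → u′≉v′ (F₂.trans (F₂.sym t≈u′) (F₂.trans (F₂.sym w≈t) w≈v′))

    -- The cells form a partition

    Triple : Fin (suc n) → Pred Carrier _
    Triple i = Elements (triple (e i * e i))

    Sixtuple : Fin (length lines) → Pred Carrier _
    Sixtuple r = Elements (line (lookup lines r))

    cell : Fin (suc n) ⊎ Fin (length lines) → Pred Carrier _
    cell = [ Triple , Sixtuple ]′

    isTriple : ∀ i → IsTriple (Triple i)
    isTriple i = e i * e i , triple-distinct (*-≉₂0 (e≉₂0 i) (e≉₂0 i)) , id , id

    isSixtuple : ∀ r → IsSixtuple (Sixtuple r)
    isSixtuple r = _ , _ , sixtuple-distinct (pair-independent (lookup lines r)) , id , id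

    representative : ∀ p → ∃[ r ] lookup lines r ∼ p
    representative p = Any.index (∈-lines p) , Any.lookup-index (∈-lines p)

    ≐-line : ∀ {u v p p′} → p′ ∼ p → u ≈₂ fst p → v ≈₂ snd p → Elements (sixtuple u v) ≐ Elements (line p′)
    ≐-line {u} {v} {p} {p′} p′∼p u≈ v≈ = ≐-trans (sixtuple-cong u≈ v≈) (≐-sym (∼⇒≐ {p′} {p} p′∼p))

    line-of : ∀ {u v} → Independent u v → ∃[ r ] Elements (sixtuple u v) ≐ Sixtuple r
    line-of {u} {v} ind = through (locate ind)
      where
      through : ∃[ p ] (u ≈₂ fst p × v ≈₂ snd p) → ∃[ r ] Elements (sixtuple u v) ≐ Sixtuple r
      through (p , u≈ , v≈) = Product.map₂
        (λ {r} r∼p → ≐-line {p = p} {p′ = lookup lines r} r∼p u≈ v≈) (representative p)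

    -- The element 2z depends only on z modulo 2, and every nonzero residue is a square of some
    -- `e i`.
    even-covered : ∀ {x z} → ¬ x ≈ 0# → x ≈ 0# + z * two → ∃[ i ] Triple i x
    even-covered {x} {z} x≉0 x≈ = in-triple (square z≉0)
      where
      open ≈-Reasoning
      x≈2z : x ≈ two * z
      x≈2z = trans x≈ (solve 1 (λ z → con 0 :+ z :* con 2 := con 2 :* z) refl z)
      z≉0 : ¬ z ≈₂ 0#
      z≉0 z≈0 = x≉0 (trans x≈2z (trans (two-*-cong z≈0) (zeroʳ two)))
      in-triple : ∃[ i ] z ≈₂ e i * e i → ∃[ i ] Triple i x
      in-triple (i , z≈a) = i , 2nd (begin
        x                  ≈⟨ x≈2z ⟩
        two * z            ≈⟨ two-*-cong z≈a ⟩
        two * a            ≈⟨ solve 1 (λ a → con 2 :* a := a :+ (a :+ con 0)) refl a ⟩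
        a + (a + 0#)       ∎)
        where
        a : Carrier
        a = e i * e i

    -- Solves u² + 2uv = u² + 2z for v by dividing by u, with w as the inverse of u.
    value-of-q : ∀ {u w z x} → u * w ≈ 1# → x ≈ u * u + z * two → x ≈ q u (w * z)
    value-of-q {u} {w} {z} {x} uw≈1 x≈ = begin
      x                              ≈⟨ x≈ ⟩
      u * u + z * two                ≈⟨ +-congˡ (*-congʳ (*-identityˡ z)) ⟨
      u * u + (1# * z) * two         ≈⟨ +-congˡ (*-congʳ (*-congʳ uw≈1)) ⟨
      u * u + ((u * w) * z) * two
        ≈⟨ solve 3 (λ u w z → u :* u :+ ((u :* w) :* z) :* con 2 := u :* u :+ con 2 :* (u :* (w :* z))) refl u w z ⟩
      q u (w * z)                    ∎
      where open ≈-Reasoning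

    value-covered : ∀ {i v x} → x ≈ q (e i) v → Dec (v ≈₂ 0#) → Dec (e i + v ≈₂ 0#) → ∃[ j ] cell j x
    value-covered {i} {v} {x} x≈q (yes v≈0) _ = inj₁ i , 1st (begin
      x              ≈⟨ x≈q ⟩
      q u v          ≈⟨ q-cong F₂.refl v≈0 ⟩
      q u 0#         ≈⟨ solve 1 (λ u → u :* u :+ con 2 :* (u :* con 0) := u :* u) refl u ⟩
      u * u          ∎)
      where
      open ≈-Reasoning
      u : Carrier
      u = e i
    value-covered {i} {v} {x} x≈q (no _) (yes u+v≈0) = inj₁ i , 3rd (begin
      x              ≈⟨ x≈q ⟩
      q u v          ≈⟨ q-cong F₂.refl (F₂.sym (sum≈₂0⇒≈₂ u+v≈0)) ⟩
      q u u
        ≈⟨ solve 1 (λ u → u :* u :+ con 2 :* (u :* u) := u :* u :+ (u :* u :+ (u :* u :+ con 0))) refl u ⟩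
      u * u + (u * u + (u * u + 0#))    ∎)
      where
      open ≈-Reasoning
      u : Carrier
      u = e i
    value-covered {i} x≈q (no v≉0) (no u+v≉0) = in-line (line-of (e≉₂0 i , v≉0 , u+v≉0 ∘ ≈₂⇒sum≈₂0))
      where
      in-line : ∃[ r ] Elements (sixtuple (e i) _) ≐ Sixtuple r → _
      in-line (r , f , _) = inj₂ r , f (1st x≈q)

    unit-covered : ∀ {i z x} → x ≈ e i * e i + z * two → ∃[ j ] cell j x
    unit-covered {i} {z} x≈ = let w , uw≈1 = e-inverse i in
      value-covered {i} {w * z} (value-of-q uw≈1 x≈) ((w * z) ≟₂0) ((e i + w * z) ≟₂0)

    covers : ∀ {x} → Nonzero x → ∃[ j ] cell j x
    covers {x} x≉0 = by-parity (x ≟₂0)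
      where
      by-parity : Dec (x ≈₂ 0#) → ∃[ j ] cell j x
      by-parity (yes x≈₂0) = Product.map inj₁ id (even-covered x≉0 (proj₂ (decompose x≈₂0)))
      by-parity (no x≉₂0)  = unit-covered {proj₁ (square x≉₂0)} (proj₂ (decompose (proj₂ (square x≉₂0))))

    sixtuple-nonzero : ∀ {u v x} → Independent u v → Elements (sixtuple u v) x → ¬ x ≈₂ 0#
    sixtuple-nonzero ind x∈ x≈0 = value-nonzero (basis ind x∈)
      where
      value-nonzero : ¬ Basis _ _ _
      value-nonzero (mkBasis _ v′ (u′≉0 , _) x≈ _) = q≉₂0 v′ u′≉0 (F₂.trans (≈⇒≈₂ (sym x≈)) x≈0)

    inside : ∀ j → cell j ⊆ Nonzero
    inside (inj₁ i) x∈     = triple-nonzero (e≉₂0 i) (triple-element x∈)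
    inside (inj₂ r) x∈ x≈0 = sixtuple-nonzero (pair-independent (lookup lines r)) x∈ (≈⇒≈₂ x≈0)

    triple-sixtuple-disjoint : ∀ {i r x} → Triple i x → ¬ Sixtuple r x
    triple-sixtuple-disjoint {i} {r} x∈ x∈′ =
      triple-not-sixtuple (e≉₂0 i) (triple-element x∈) (basis (pair-independent (lookup lines r)) x∈′)

    disjoint : ∀ {x} j k → cell j x → cell k x → j ≡ k
    disjoint (inj₁ i) (inj₁ j) x∈ x∈′ = ≡.cong inj₁ (power-injective i j
      (triple-determines (e≉₂0 i) (e≉₂0 j) (triple-element x∈) (triple-element x∈′)))
    disjoint (inj₁ i) (inj₂ r) x∈ x∈′ = contradiction x∈′ (triple-sixtuple-disjoint {i} {r} x∈)
    disjoint (inj₂ r) (inj₁ i) x∈ x∈′ = contradiction x∈ (triple-sixtuple-disjoint {i} {r} x∈′)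
    disjoint (inj₂ r) (inj₂ s) x∈ x∈′ =
      ≡.cong inj₂ (unique-lookup-injective (DecSetoid.setoid ∼-decSetoid) lines!
        (meet⇒∼ {lookup lines r} {lookup lines s} x∈ x∈′))

    isPartition : IsPartition cell Nonzero
    isPartition = record
      { nonempty = λ { (inj₁ i) → _ , here refl ; (inj₂ r) → _ , here refl }
      ; inside   = inside
      ; covers   = covers
      ; disjoint = λ {_} {j} {k} → disjoint j k
      }

    -- Invariance of the partition

    image-Elements : ∀ {ψ xs ys} → (∀ {x y} → x ≈ y → ψ x ≈ ψ y) → Pointwise (λ x y → ψ x ≈ y) xs ys →
                     Image ψ (Elements xs) ≐ Elements ys
    image-Elements {ψ} ψ-cong xs↦ys = (λ (x , x∈ , ψx≈y) → Elements-resp ψx≈y (to xs↦ys x∈)) , from xs↦ys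
      where
      to : ∀ {xs ys x} → Pointwise (λ x y → ψ x ≈ y) xs ys → Elements xs x → Elements ys (ψ x)
      to (x↦y ∷ _)     (here p)  = here (trans (ψ-cong p) x↦y)
      to (_ ∷ xs↦ys)   (there p) = there (to xs↦ys p)
      from : ∀ {xs ys y} → Pointwise (λ x y → ψ x ≈ y) xs ys → Elements ys y → Image ψ (Elements xs) y
      from (x↦y ∷ _)   (here p)  = _ , here refl , trans x↦y (sym p)
      from (_ ∷ xs↦ys) (there p) with from xs↦ys p
      ... | x , x∈ , ψx≈y = x , there x∈ , ψx≈y

    module _ {τ : Carrier} (τ≉0 : ¬ τ ≈₂ 0#) {φ : Carrier → Carrier}
             (φ-mono : RingMorphisms.IsRingMonomorphism rawRing rawRing φ) where
      open RingMorphisms.IsRingMonomorphism φ-mono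
        using (⟦⟧-cong; +-homo; *-homo; -‿homo; 0#-homo; 1#-homo; injective)
      open ≈-Reasoning

      private
        -- One family of maps serves both symmetries: τ = σ with φ the identity gives multiplication
        -- by ξ, and τ = 1 gives φ itself. Since q is homogeneous of degree 2, ψ acts on its values
        -- as f acts on the arguments.
        f ψ : Carrier → Carrier
        f x = τ * φ x
        ψ x = (τ * τ) * φ x

      φ-two-* : ∀ x → φ (two * x) ≈ two * φ x
      φ-two-* x = begin
        φ (two * x)              ≈⟨ *-homo two x ⟩
        φ two * φ x              ≈⟨ *-congʳ (trans (+-homo 1# 1#) (+-cong 1#-homo 1#-homo)) ⟩
        two * φ x                ∎

      -- Injectivity passes from R to F because vanishing of x modulo 2 is the same as 2x = 0 in R,
      -- a condition that φ preserves and reflects.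
      φ≉₂0 : ∀ {x} → ¬ x ≈₂ 0# → ¬ φ x ≈₂ 0#
      φ≉₂0 {x} x≉0 φx≈0 = x≉0 (two-cancel (injective (begin
        φ (two * x)      ≈⟨ φ-two-* x ⟩
        two * φ x        ≈⟨ two-*-cong φx≈0 ⟩
        two * 0#         ≈⟨ zeroʳ two ⟩
        0#               ≈⟨ 0#-homo ⟨
        φ 0#             ∎)))

      f≉₂0 : ∀ {x} → ¬ x ≈₂ 0# → ¬ f x ≈₂ 0#
      f≉₂0 = *-≉₂0 τ≉0 ∘ φ≉₂0

      f-+ : ∀ x y → f (x + y) ≈ f x + f y
      f-+ x y = trans (*-congˡ (+-homo x y)) (distribˡ τ (φ x) (φ y))

      f-independent : ∀ {u v} → Independent u v → Independent (f u) (f v)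
      f-independent {u} {v} (u≉0 , v≉0 , u≉v) = f≉₂0 u≉0 , f≉₂0 v≉0 ,
        λ fu≈fv → f≉₂0 (u≉v ∘ sum≈₂0⇒≈₂) (F₂.trans (≈⇒≈₂ (f-+ u v)) (≈₂⇒sum≈₂0 fu≈fv))

      ψ-cong : ∀ {x y} → x ≈ y → ψ x ≈ ψ y
      ψ-cong x≈y = *-congˡ (⟦⟧-cong x≈y)

      ψ-+ : ∀ {x y x′ y′} → ψ x ≈ x′ → ψ y ≈ y′ → ψ (x + y) ≈ x′ + y′
      ψ-+ {x} {y} p p′ = trans (*-congˡ (+-homo x y)) (trans (distribˡ (τ * τ) (φ x) (φ y)) (+-cong p p′))

      ψ-neg : ∀ {x x′} → ψ x ≈ x′ → ψ (- x) ≈ - x′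
      ψ-neg {x} p = trans (*-congˡ (-‿homo x)) (trans (sym (-‿distribʳ-* (τ * τ) (φ x))) (-‿cong p))

      ψ-0 : ψ 0# ≈ 0#
      ψ-0 = trans (*-congˡ 0#-homo) (zeroʳ (τ * τ))

      ψ-square : ∀ u → ψ (u * u) ≈ f u * f u
      ψ-square u = trans (*-congˡ (*-homo u u))
        (solve 2 (λ t x → (t :* t) :* (x :* x) := (t :* x) :* (t :* x)) refl τ (φ u))

      ψ-q : ∀ u v → ψ (q u v) ≈ q (f u) (f v)
      ψ-q u v = ψ-+ (ψ-square u) (begin
        (τ * τ) * φ (two * (u * v))        ≈⟨ *-congˡ (trans (φ-two-* (u * v)) (*-congˡ (*-homo u v))) ⟩
        (τ * τ) * (two * (φ u * φ v))
          ≈⟨ solve 3 (λ t x y → (t :* t) :* (con 2 :* (x :* y)) := con 2 :* ((t :* x) :* (t :* y)))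
               refl τ (φ u) (φ v) ⟩
        two * (f u * f v)                  ∎)

      image-sixtuple : ∀ u v → Image ψ (Elements (sixtuple u v)) ≐ Elements (sixtuple (f u) (f v))
      image-sixtuple u v = image-Elements ψ-cong
        (a ∷ ψ-neg a ∷ b ∷ ψ-neg b ∷ ψ-+ a b ∷ ψ-neg (ψ-+ a b) ∷ [])
        where
        a = ψ-q u v
        b = ψ-neg (ψ-q v u)

      image-triple : ∀ {u v} → f u ≈₂ v → Image ψ (Elements (triple (u * u))) ≐ Elements (triple (v * v))
      image-triple {u} fu≈v = image-Elements ψ-cong (a ∷ ψ-+ a (ψ-+ a ψ-0) ∷ ψ-+ a (ψ-+ a (ψ-+ a ψ-0)) ∷ [])
        where
        a = trans (ψ-square u) (square-cong fu≈v)

      invariant : InvariantUnder cell ψ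
      invariant (inj₁ i) = Product.map inj₁ image-triple (power (f≉₂0 (e≉₂0 i)))
      invariant (inj₂ r) = Product.map inj₂ (≐-trans (image-sixtuple _ _))
        (line-of (f-independent (pair-independent (lookup lines r))))

    image-cong : ∀ {p} {C : Pred Carrier p} {ψ ψ′} → (∀ x → ψ x ≈ ψ′ x) → Image ψ C ≐ Image ψ′ C
    image-cong ψ≈ψ′ = (λ (x , x∈ , eq) → x , x∈ , trans (sym (ψ≈ψ′ x)) eq)
                    , (λ (x , x∈ , eq) → x , x∈ , trans (ψ≈ψ′ x) eq)

    σ≉₂0 : ¬ σ ≈₂ 0#
    σ≉₂0 σ≈0 = unit≉₂0 (≈⇒≈₂ ξ^[1+n]≈1) (F₂.trans (≈⇒≈₂ (sym σ²≈ξ)) (F₂.trans (F₂.*-congʳ σ≈0) (F₂.zeroˡ σ)))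

    invariant-ξ : InvariantUnder cell (ξ *_)
    invariant-ξ j = Product.map₂ (≐-trans (image-cong (λ x → *-congʳ (sym σ²≈ξ))))
      (invariant σ≉₂0 (Identity.isRingMonomorphism rawRing refl) j)

    invariant-monomorphism : ∀ {φ} → RingMorphisms.IsRingMonomorphism rawRing rawRing φ → InvariantUnder cell φ
    invariant-monomorphism φ-mono j =
      Product.map₂ (≐-trans (image-cong (λ x → sym (trans (*-congʳ (*-identityˡ 1#)) (*-identityˡ _)))))
        (invariant 1≉₂0 φ-mono j)

-- Integer representatives: from ℤ₄ to 𝔽₂

module ℤ/4 = Quotient ℤ.+-*-commutativeRing (+ 4)
module ℤ/2 = Quotient ℤ.+-*-commutativeRing (+ 2)
module ℤ₄-Poly = PolynomialRing ℤ/4.quotientRing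
module 𝔽₂-Poly = PolynomialRing ℤ/2.quotientRing
module ℤ₄ = Polynomial ℤ₄
module 𝔽₂ = Polynomial 𝔽₂

open RawMagmaDefinitions using (_,_)

mod4⇒mod2 : ∀ a b → a ℤ/4.≈ₘ b → a ℤ/2.≈ₘ b
mod4⇒mod2 a b (q , eq) = q ℤ.* + 2 , ≡.trans (ℤ.*-assoc q (+ 2) (+ 2)) eq

-- The integer operations underlying ℤ₄ and 𝔽₂ are the same, but the polynomial functions built over
-- the two rings are separate instances, identified here by induction on the list.
coeff-mod2 : ∀ f n → ℤ₄.coeff f n ≡ 𝔽₂.coeff f n
coeff-mod2 []      n       = ≡.refl
coeff-mod2 (a ∷ f) zero    = ≡.refl
coeff-mod2 (a ∷ f) (suc n) = coeff-mod2 f n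

add-mod2 : ∀ f g → ℤ₄.add f g ≡ 𝔽₂.add f g
add-mod2 []      g       = ≡.refl
add-mod2 (a ∷ f) []      = ≡.refl
add-mod2 (a ∷ f) (b ∷ g) = ≡.cong (a ℤ.+ b ∷_) (add-mod2 f g)

mul-mod2 : ∀ f g → ℤ₄.mul f g ≡ 𝔽₂.mul f g
mul-mod2 []      g = ≡.refl
mul-mod2 (a ∷ f) g = ≡.trans (add-mod2 (map (a ℤ.*_) g) (+ 0 ∷ ℤ₄.mul f g))
                             (≡.cong (λ k → 𝔽₂.add (map (a ℤ.*_) g) (+ 0 ∷ k)) (mul-mod2 f g))

≋-mod2 : ∀ {f g} → f ℤ₄-Poly.≋ g → f 𝔽₂-Poly.≋ g
≋-mod2 {f} {g} f≋g .𝔽₂-Poly._≋_.at n =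
  ≡.subst₂ ℤ/2._≈ₘ_ (coeff-mod2 f n) (coeff-mod2 g n)
    (mod4⇒mod2 (ℤ₄.coeff f n) (ℤ₄.coeff g n) (ℤ₄-Poly._≋_.at f≋g n))

-- Halving takes place on integer representatives, so the equation is exact and can afterwards be
-- read modulo 4.
half-of-even : ∀ f → (∀ n → ℤ₄.coeff f n ℤ/2.≈ₘ + 0) →
               ∃[ g ] ∀ n → ℤ₄.coeff f n ≡ ℤ₄.coeff (ℤ₄-Poly.scale (+ 2) g) n
half-of-even []      even = [] , λ _ → ≡.refl
half-of-even (a ∷ f) even with half-of-even f (even ∘ suc)
... | g , f≡2g = b ∷ g , eq
  where
  b : ℤ
  b = RawMagmaDefinitions._∣ʳ_.quotient (even 0)
  eq : ∀ n → ℤ₄.coeff (a ∷ f) n ≡ ℤ₄.coeff (ℤ₄-Poly.scale (+ 2) (b ∷ g)) n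
  eq zero    = ≡.trans (ℤ/2.unshift {a} {+ 0} (even 0)) (≡.trans (ℤ.+-identityˡ _) (ℤ.*-comm b (+ 2)))
  eq (suc n) = f≡2g n

bit : ℤ → Fin 2
bit a = Fin.fromℕ< (ℤ.n%ℕd<d a 2)

bit-injective : ∀ {a b} → bit a ≡ bit b → a ℤ/2.≈ₘ b
bit-injective {a} {b} eq = begin
  a              ≈⟨ ≈-residue a ⟩
  + (a ℤ.%ℕ 2)   ≡⟨ ≡.cong +_ residues≡ ⟩
  + (b ℤ.%ℕ 2)   ≈⟨ ≈-residue b ⟨
  b              ∎
  where
  open SetoidReasoning (CommutativeRing.setoid ℤ/2.quotientRing)
  ≈-residue : ∀ a → a ℤ/2.≈ₘ + (a ℤ.%ℕ 2)
  ≈-residue a = ℤ/2.shift (a ℤ./ℕ 2) (ℤ.a≡a%ℕn+[a/ℕn]*n a 2)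
  residues≡ : a ℤ.%ℕ 2 ≡ b ℤ.%ℕ 2
  residues≡ = ≡.trans (≡.sym (Fin.toℕ-fromℕ< _)) (≡.trans (≡.cong toℕ eq) (Fin.toℕ-fromℕ< _))

2≉0-mod4 : ¬ + 2 ℤ/4.≈ₘ + 0
2≉0-mod4 (q , eq) = impossible ℤ.∣ q ∣ (≡.trans (≡.sym (ℤ.abs-* q (+ 4))) (≡.cong ℤ.∣_∣ eq))
  where
  impossible : ∀ n → n ℕ.* 4 ≡ 2 → _
  impossible zero    ()
  impossible (suc n) ()

-- The Galois ring: 4 = 0 and 2 ≠ 0

module GaloisRing (Δ : ℕ) (0<Δ : 0 ℕ.< Δ) (h : List ℤ) (basic : IsBasicPrimitive Δ h) where
  open IsBasicPrimitive basic

  module ℤ₄[X]/h = Quotient ℤ₄-Poly.polynomialRing h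

  R : CommutativeRing _ _
  R = ℤ₄[X]/h.quotientRing

  open CommutativeRing R using (_≈_; _+_; _*_; -_; 0#; 1#; semiring)
  open Exp semiring using (_^_)

  t : ℕ
  t = 2 ℕ.^ Δ ℕ.∸ 1

  lift : ∀ {f g} → f ℤ₄-Poly.≋ g → f ≈ g
  lift {f} {g} f≋g = ℤ₄[X]/h.≈⇒≈ₘ {f} {g} (ℤ₄-Poly._≋_.at f≋g)

  4≈0 : (1# + 1#) + (1# + 1#) ≈ 0#
  4≈0 = lift {(1# + 1#) + (1# + 1#)} {0#} (ℤ₄-Poly.pointwise λ where
    zero    → + 1 , ≡.refl
    (suc n) → ℤ/4.≈⇒≈ₘ {+ 0} ≡.refl)

  -- If 2 = q h in ℤ₄[X], the product has no coefficient in degree Δ or above, because Δ is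
  -- positive. Then q = 0 as h is monic, and 2 would vanish in ℤ₄.
  2≉0 : ¬ 1# + 1# ≈ 0#
  2≉0 2≈0 = 2≉0-mod4 (ℤ/4.transₘ {+ 2} {ℤ₄.coeff (ℤ₄.mul q h) 0} {+ 0}
    (at 2≋qh 0) (at (mul-vanishing q h q≋[]) 0))
    where
    open ℤ₄-Poly
    open _≋_
    module M = Monic ℤ/4.quotientRing h Δ monic
    q : List ℤ
    q = RawMagmaDefinitions._∣ʳ_.quotient 2≈0
    2≋qh : (+ 2 ∷ []) ≋ ℤ₄.mul q h
    2≋qh = pointwise (ℤ₄[X]/h.unshift {1# + 1#} {0#} 2≈0)
    q≋[] : q ≋ []
    q≋[] = M.multiple-of-low-degree q low
      where
      low : M.VanishesFrom Δ (ℤ₄.mul q h)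
      low {zero}  Δ≤0 = contradiction (ℕ.<-≤-trans 0<Δ Δ≤0) (ℕ.<-irrefl ≡.refl)
      low {suc k} _   = ℤ/4.symₘ {+ 0} {ℤ₄.coeff (ℤ₄.mul q h) (suc k)} (at 2≋qh (suc k))

  X^-agree : ∀ n → RawSemiringDefinitions._^_ (RawRing.rawSemiring ℤ₄[X]) ℤ₄.X n ≡ ℤ₄.X ^ n
  X^-agree zero    = ≡.refl
  X^-agree (suc n) = ≡.cong (ℤ₄.mul ℤ₄.X) (X^-agree n)

  X^t≈1 : ℤ₄.X ^ t ≈ 1#
  X^t≈1 = ≡.subst (_≈ 1#) (X^-agree t) divides

  -- The residue ring: order of ξ and number of classes

  module F = Quotient R (1# + 1#)
  open CommutativeRing F.quotientRing using () renaming (_≈_ to _≈F_)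

  private
    mul-2 : ∀ z → ℤ₄.mul z (1# + 1#) ℤ₄-Poly.≋ ℤ₄-Poly.scale (+ 2) z
    mul-2 z = ℤ₄-Poly.≋-trans (ℤ₄-Poly.mul-comm z (1# + 1#))
      (ℤ₄-Poly.≋-trans (ℤ₄-Poly.add-cong {f = ℤ₄-Poly.scale (+ 2) z} ℤ₄-Poly.≋-refl ℤ₄-Poly.0∷[]≋[])
                       (ℤ₄-Poly.add-identityʳ _))

    mul-2-mod2 : ∀ z → ℤ₄.mul z (1# + 1#) 𝔽₂-Poly.≋ []
    mul-2-mod2 z = 𝔽₂-Poly.≋-trans (≋-mod2 (mul-2 z)) (𝔽₂-Poly.scale-zero {+ 2} z (+ 1 , ≡.refl))

  even-difference⇒≈F : ∀ {f g} → (∀ n → ℤ₄.coeff f n ℤ/2.≈ₘ ℤ₄.coeff g n) → f ≈F g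
  even-difference⇒≈F {f} {g} f≈g = z , lift (ℤ₄-Poly.≋-trans (mul-2 z) (ℤ₄-Poly.≋-sym halves))
    where
    even : ∀ n → ℤ₄.coeff (f + - g) n ℤ/2.≈ₘ + 0
    even n = begin
      ℤ₄.coeff (f + - g) n
        ≈⟨ mod4⇒mod2 (ℤ₄.coeff (f + - g) n) (a ℤ.+ ℤ₄.coeff (- g) n) (ℤ₄-Poly.coeff-add f (- g) n) ⟩
      a ℤ.+ ℤ₄.coeff (- g) n
        ≈⟨ +-congˡ {a} {ℤ₄.coeff (- g) n} {ℤ.- b}
             (mod4⇒mod2 (ℤ₄.coeff (- g) n) (ℤ.- b) (ℤ₄-Poly.coeff-neg g n)) ⟩
      a ℤ.+ ℤ.- b                        ≈⟨ +-congʳ {ℤ.- b} {a} {b} (f≈g n) ⟩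
      b ℤ.+ ℤ.- b                        ≡⟨ ℤ.+-inverseʳ b ⟩
      + 0                                ∎
      where
      open CommutativeRing ℤ/2.quotientRing using (+-congˡ; +-congʳ; setoid)
      open SetoidReasoning setoid
      a b : ℤ
      a = ℤ₄.coeff f n
      b = ℤ₄.coeff g n
    z : List ℤ
    z = proj₁ (half-of-even (f + - g) even)
    halves : (f + - g) ℤ₄-Poly.≋ ℤ₄-Poly.scale (+ 2) z
    halves = ℤ₄-Poly.pointwise λ n → ℤ/4.≈⇒≈ₘ (proj₂ (half-of-even (f + - g) even) n)

  -- Equality in F means f = g + 2z + q h over ℤ₄, and the term 2z disappears modulo 2. Through this
  -- map a relation Xᵐ = 1 in F becomes one in 𝔽₂[X]/(h), where primitivity bounds m from below.
  ≈F⇒mod2 : ∀ {f g} → f ≈F g → RawRing._≈_ (𝔽₂[X] /⟨ h ⟩) f g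
  ≈F⇒mod2 {f} {g} f≈g = Quotient.shift 𝔽₂-Poly.polynomialRing h {f} {g} q (at f≋)
    where
    open 𝔽₂-Poly
    open _≋_
    z q : List ℤ
    z = RawMagmaDefinitions._∣ʳ_.quotient f≈g
    q = RawMagmaDefinitions._∣ʳ_.quotient (F.unshift {f} {g} f≈g)
    f≋ : f ≋ 𝔽₂.add g (𝔽₂.mul q h)
    f≋ = ≋-trans (≋-mod2 (ℤ₄-Poly.pointwise (ℤ₄[X]/h.unshift {f} {g + z * (1# + 1#)} (F.unshift {f} {g} f≈g))))
      (≡.subst (_≋ 𝔽₂.add g (𝔽₂.mul q h))
        (≡.sym (≡.trans (add-mod2 (ℤ₄.add g (ℤ₄.mul z (1# + 1#))) (ℤ₄.mul q h))
                        (≡.cong₂ 𝔽₂.add (add-mod2 g _) (mul-mod2 q h))))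
        (add-cong (≋-trans (add-cong {f = g} ≋-refl (mul-2-mod2 z)) (add-identityʳ g)) ≋-refl))

  open IsPrimitive reduction using (order)
  open HasOrder order

  𝔽₂-X^-agree : ∀ n → ℤ₄.X ^ n ≡ RawSemiringDefinitions._^_ (RawRing.rawSemiring (𝔽₂[X] /⟨ h ⟩)) 𝔽₂.X n
  𝔽₂-X^-agree zero    = ≡.refl
  𝔽₂-X^-agree (suc n) = ≡.trans (mul-mod2 ℤ₄.X (ℤ₄.X ^ n)) (≡.cong (𝔽₂.mul ℤ₄.X) (𝔽₂-X^-agree n))

  F-X^-agree : ∀ n → Exp._^_ (CommutativeRing.semiring F.quotientRing) ℤ₄.X n ≡ ℤ₄.X ^ n
  F-X^-agree zero    = ≡.refl
  F-X^-agree (suc n) = ≡.cong (ℤ₄.mul ℤ₄.X) (F-X^-agree n)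

  ξ-order : HasOrder (CommutativeRing.rawRing F.quotientRing) ℤ₄.X t
  ξ-order = record
    { positive = positive
    ; power    = ≡.subst (_≈F 1#) (≡.sym (F-X^-agree t)) (F.≈⇒≈ₘ {ℤ₄.X ^ t} {1#} X^t≈1)
    ; minimal  = λ {m} 0<m m<t Xᵐ≈1 → minimal 0<m m<t
        (≡.subst (λ f → RawRing._≈_ (𝔽₂[X] /⟨ h ⟩) f 1#) (≡.trans (F-X^-agree m) (𝔽₂-X^-agree m))
          (≈F⇒mod2 {Exp._^_ (CommutativeRing.semiring F.quotientRing) ℤ₄.X m} {1#} Xᵐ≈1))
    }

  private
    module M = Monic ℤ/4.quotientRing h Δ monic
    module D f = M.Division (M.divide f)

  code : List ℤ → Fin (2 ℕ.^ Δ)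
  code f = Fin.funToFin λ i → bit (ℤ₄.coeff (D.remainder f) (toℕ {Δ} i))

  -- Each polynomial equals its remainder modulo h, and an element of F is unchanged when
  -- coefficients are altered by even amounts. Only the Δ parities recorded by `code` remain, which
  -- bounds F by 2^Δ classes.
  code-injective : ∀ {f g} → code f ≡ code g → f ≈F g
  code-injective {f} {g} eq = F.transₘ {f} {D.remainder f} {g} (≈F-remainder f)
    (F.transₘ {D.remainder f} {D.remainder g} {g} (even-difference⇒≈F {D.remainder f} {D.remainder g} same-coeffs)
      (F.symₘ {g} {D.remainder g} (≈F-remainder g)))
    where
    ≈F-remainder : ∀ f → f ≈F D.remainder f
    ≈F-remainder f = F.≈⇒≈ₘ {f} {D.remainder f}
      (ℤ₄[X]/h.shift {f} {D.remainder f} (D.quotient f) (ℤ₄-Poly._≋_.at (D.equation f)))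

    same-bits : ∀ i → bit (ℤ₄.coeff (D.remainder f) (toℕ {Δ} i)) ≡ bit (ℤ₄.coeff (D.remainder g) (toℕ i))
    same-bits i = ≡.trans (≡.sym (Fin.finToFun-funToFin (λ i → bit (ℤ₄.coeff (D.remainder f) (toℕ {Δ} i))) i))
      (≡.trans (≡.cong (λ k → Fin.finToFun {2} {Δ} k i) eq)
               (Fin.finToFun-funToFin (λ i → bit (ℤ₄.coeff (D.remainder g) (toℕ {Δ} i))) i))

    same-coeffs : ∀ n → ℤ₄.coeff (D.remainder f) n ℤ/2.≈ₘ ℤ₄.coeff (D.remainder g) n
    -- Below Δ the recorded bits agree; from Δ on both remainders vanish.
    same-coeffs n with ℕ.<-≤-connex n Δ
    ... | inj₁ n<Δ = ≡.subst (λ k → ℤ₄.coeff (D.remainder f) k ℤ/2.≈ₘ ℤ₄.coeff (D.remainder g) k)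
                             (Fin.toℕ-fromℕ< n<Δ)
      (bit-injective {ℤ₄.coeff (D.remainder f) _} {ℤ₄.coeff (D.remainder g) _} (same-bits (Fin.fromℕ< n<Δ)))
    ... | inj₂ Δ≤n = mod4⇒mod2 (r f) (r g)
      (ℤ/4.transₘ {r f} {+ 0} {r g} (D.lowDegree f Δ≤n) (ℤ/4.symₘ {r g} {+ 0} (D.lowDegree g Δ≤n)))
      where
      r : List ℤ → ℤ
      r f = ℤ₄.coeff (D.remainder f) n

-- The partition of the Galois ring

open import Data.Nat.Base using (_^_; _∸_) renaming (_*_ to _*ℕ_)

module Assembly (d : ℕ) (h : RawRing.Carrier ℤ₄[X]) (basic : IsBasicPrimitive (ℕ.suc d) h) where
  open GaloisRing (ℕ.suc d) ℕ.z<s h basic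
  open CommutativeRing R using (Carrier; _≈_; _+_; _*_; 0#; 1#; semiring; setoid; *-congˡ; *-identityʳ)
  open LiftedSquares R 4≈0 using (_≈₂_; module Enumerated)
  open Exp semiring using (^-homo-*) renaming (_^_ to _^ᴿ_)
  open CommutativeRing F.quotientRing using () renaming (rawRing to F-rawRing)

  -- Chosen so that F has `suc n` nonzero elements, leaving n choices for the second vector of a
  -- basis.
  n : ℕ
  n = 2 ^ ℕ.suc d ∸ 2

  2^Δ≡2+n : 2 ^ ℕ.suc d ≡ ℕ.suc (ℕ.suc n)
  2^Δ≡2+n = ≡.sym (ℕ.m+[n∸m]≡n (ℕ.*-monoʳ-≤ 2 (ℕ.m^n>0 2 d)))

  t≡1+n : t ≡ ℕ.suc n
  t≡1+n = ≡.cong (_∸ 1) 2^Δ≡2+n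

  module Powers = PowersExhaust.Bounded F.quotientRing (LiftedSquares.nontrivial-mod-2 R 4≈0 2≉0) ℤ₄.X (ℕ.suc n)
    (≡.subst (HasOrder F-rawRing ℤ₄.X) t≡1+n ξ-order)
    (λ f → ≡.subst Fin 2^Δ≡2+n (code f))
    (λ {f} {g} eq → code-injective {f} {g} (≡.subst-injective 2^Δ≡2+n eq))

  0-or-power : ∀ x → x ≈₂ 0# ⊎ ∃[ k ] x ≈₂ ℤ₄.X ^ᴿ Fin.toℕ {ℕ.suc n} k
  0-or-power x = Sum.map₂ (λ (k , x≈) → k , ≡.subst (x ≈₂_) (F-X^-agree (Fin.toℕ k)) x≈) (Powers.0-or-power x)

  power-injective : (i j : Fin (ℕ.suc n)) → ℤ₄.X ^ᴿ Fin.toℕ i ≈₂ ℤ₄.X ^ᴿ Fin.toℕ j → i ≡ j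
  power-injective i j eq = Powers.^-injective i j
    (≡.subst₂ _≈₂_ (≡.sym (F-X^-agree (Fin.toℕ i))) (≡.sym (F-X^-agree (Fin.toℕ j))) eq)

  X^[1+n]≈1 : ℤ₄.X ^ᴿ ℕ.suc n ≈ 1#
  X^[1+n]≈1 = ≡.subst (λ k → ℤ₄.X ^ᴿ k ≈ 1#) t≡1+n X^t≈1

  -- The exponent is half of 2^Δ, where Δ is `suc d`. Since ξ has exponent 2^Δ - 1, the square of σ
  -- is ξ itself.
  σ : Carrier
  σ = ℤ₄.X ^ᴿ (2 ^ d)

  σ²≈X : σ * σ ≈ ℤ₄.X
  σ²≈X = begin
    σ * σ                              ≈⟨ ^-homo-* ℤ₄.X (2 ^ d) (2 ^ d) ⟨
    ℤ₄.X ^ᴿ (2 ^ d ℕ.+ 2 ^ d)          ≡⟨ ≡.cong (λ k → ℤ₄.X ^ᴿ (2 ^ d ℕ.+ k)) (ℕ.+-identityʳ (2 ^ d)) ⟨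
    ℤ₄.X ^ᴿ (2 ^ ℕ.suc d)              ≡⟨ ≡.cong (ℤ₄.X ^ᴿ_) 2^Δ≡2+n ⟩
    ℤ₄.X * ℤ₄.X ^ᴿ ℕ.suc n             ≈⟨ *-congˡ {ℤ₄.X} {ℤ₄.X ^ᴿ ℕ.suc n} {1#} X^[1+n]≈1 ⟩
    ℤ₄.X * 1#                          ≈⟨ *-identityʳ ℤ₄.X ⟩
    ℤ₄.X                               ∎
    where open SetoidReasoning setoid

  open Enumerated 2≉0 ℤ₄.X n X^[1+n]≈1 0-or-power power-injective σ σ²≈X public

  length-lines≡ : length lines ≡ ((2 ^ ℕ.suc d ∸ 1) *ℕ n) / 6
  length-lines≡ = ≡.trans (≡.sym (ℕ.m*n/n≡m (length lines) 6))
    (≡.cong (_/ 6) (≡.trans length-lines (≡.cong (_*ℕ n) (≡.sym t≡1+n))))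

-- The claim with the two numbers of cells as parameters: the construction yields `suc n` triples
-- and `length lines` sixtuples, and the required counts are reached by substitution.
HasInvariantPartition : (h : RawRing.Carrier ℤ₄[X]) (Δ t s : ℕ) → Set₁
HasInvariantPartition h Δ t s =
  let open RawRing (GR h)
      open Cells (GR h)
  in
  Σ[ triple ∈ (Fin t → Pred Carrier 0ℓ) ]
  Σ[ sixtuple ∈ (Fin s → Pred Carrier 0ℓ) ]
  let cell = [ triple , sixtuple ]′ in
    (∀ i → IsTriple (triple i)) ×
    (∀ j → IsSixtuple (sixtuple j)) ×
    IsPartition cell Nonzero ×
    InvariantUnder cell (λ x → ξ h * x) ×
    (Δ % 3 ≢ 0 →
      ∀ (φ : Carrier → Carrier) → IsRingAutomorphism (GR h) φ →
      InvariantUnder cell φ)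

theorem3 :
    (Δ : ℕ) → Δ % 2 ≡ 1 →
    (h : RawRing.Carrier ℤ₄[X]) → IsBasicPrimitive Δ h →
    let open RawRing (GR h)
        open Cells (GR h)
        t = 2 ^ Δ ∸ 1
        s = ((2 ^ Δ ∸ 1) *ℕ (2 ^ Δ ∸ 2)) / 6
    in
    Σ[ triple ∈ (Fin t → Pred Carrier 0ℓ) ]
    Σ[ sixtuple ∈ (Fin s → Pred Carrier 0ℓ) ]
    let cell = [ triple , sixtuple ]′ in
      (∀ i → IsTriple (triple i)) ×
      (∀ j → IsSixtuple (sixtuple j)) ×
      IsPartition cell Nonzero ×
      InvariantUnder cell (λ x → ξ h * x) ×
      (Δ % 3 ≢ 0 →
        ∀ (φ : Carrier → Carrier) → IsRingAutomorphism (GR h) φ →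
        InvariantUnder cell φ)
theorem3 ℕ.zero    ()
theorem3 (ℕ.suc d) _ h basic =
  ≡.subst₂ (HasInvariantPartition h (ℕ.suc d)) (≡.sym t≡1+n) length-lines≡
    ( Triple , Sixtuple , isTriple , isSixtuple , isPartition , invariant-ξ
    , λ _ φ φ-iso → invariant-monomorphism (RingMorphisms.IsRingIsomorphism.isRingMonomorphism φ-iso))
  where open Assembly d h basic
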